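{- Let $2 \leqslant s \leqslant t$ be integers and let $H = K_{s,t}$. There exist constants $C > 0$, $\varepsilon > 0$ and $k_0 \in \mathbb{N}$ such that the following holds. For every $n$, every $k \geqslant k_0$, and every graph $G$ with $n$ vertices and $k \cdot n^{2-1/s}$ edges, there exists a non-empty $st$-uniform hypergraph $\mathcal{H}$ on vertex set $E(G)$, each of whose edges is the edge set of a copy of $K_{s,t}$ in $G$, satisfying $$d_{\mathcal{H}}(\sigma) \leqslant \frac{C \cdot e(\mathcal{H})}{k^{(1+\varepsilon)(|\sigma|-1)}\, e(G)} \quad\text{for every } \sigma \subset V(\mathcal{H}) \text{ with } 1 \leqslant |\sigma| \leqslant st.$$
   Context: $K_{s,t}$ is the complete bipartite graph with part sizes $s$ and $t$. $d_{\mathcal{H}}(\sigma)$ is the number of edges of $\mathcal{H}$ containing $\sigma$; $e(\cdot)$ is number of edges. -}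

module Defs where

open import Data.Nat using (ℕ; zero; suc; _+_; _*_; _<ᵇ_)
open import Data.Bool using (Bool; true; false; _∧_; _∨_; not; if_then_else_)
open import Data.Fin using (Fin; toℕ)
open import Data.Vec using (Vec; lookup; toList; zipWith)
open import Data.List using (List; map; allFin; filter; length)
open import Data.Nat.ListAction using (sum)
open import Data.Bool.ListAction using (and)
open import Data.Product using (Σ; ∃; ∃₂; _×_; _,_)
open import Data.Sum using (_⊎_)
open import Relation.Binary.PropositionalEquality using (_≡_; _≢_)
open import Relation.Nullary using (¬_)
open import Function.Definitions using (Injective)
open import Function.Bundles using (_⇔_)
open import Data.Bool.Properties using () renaming (_≟_ to _≟B_)
open import Relation.Nullary.Decidable using (does)

-- A set of (unordered) pairs of vertices of Fin n, stored as an n×n Boolean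
-- adjacency matrix.  Both graphs and edge sets of graphs are stored this way.
EdgeMat : ℕ → Set
EdgeMat n = Vec (Vec Bool n) n

adj : ∀ {n} → EdgeMat n → Fin n → Fin n → Bool
adj M u v = lookup (lookup M u) v

record IsSimple {n : ℕ} (M : EdgeMat n) : Set where
  field
    symmetric : ∀ u v → adj M u v ≡ adj M v u
    loopless  : ∀ u → adj M u u ≡ false

record Graph (n : ℕ) : Set where
  field
    mat    : EdgeMat n
    simple : IsSimple mat

numEdges : ∀ {n} → EdgeMat n → ℕ
numEdges {n} M =
  sum (map (λ u → sum (map (λ v → if (toℕ u <ᵇ toℕ v) ∧ adj M u v then 1 else 0)
                           (allFin n)))
           (allFin n))

e : ∀ {n} → Graph n → ℕ
e G = numEdges (Graph.mat G)

_⊆ᵇ_ : ∀ {n} → EdgeMat n → EdgeMat n → Bool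
σ ⊆ᵇ h = and (toList (zipWith (λ r r' → and (toList (zipWith (λ a b → not a ∨ b) r r'))) σ h))

_⊆_ : ∀ {n} → EdgeMat n → EdgeMat n → Set
σ ⊆ h = ∀ u v → adj σ u v ≡ true → adj h u v ≡ true

IsKstCopy : ∀ {n} (s t : ℕ) → Graph n → EdgeMat n → Set
IsKstCopy {n} s t G h =
  Σ (Fin s → Fin n) λ A → Σ (Fin t → Fin n) λ B →
    Injective _≡_ _≡_ A × Injective _≡_ _≡_ B ×
    (∀ i j → A i ≢ B j) ×
    (∀ i j → adj (Graph.mat G) (A i) (B j) ≡ true) ×
    (∀ u v → (adj h u v ≡ true) ⇔
              (∃₂ λ i j → (u ≡ A i × v ≡ B j) ⊎ (u ≡ B j × v ≡ A i)))

-- A hypergraph on vertex set E(G): a duplicate-free list of hyperedges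
-- (each hyperedge a set of edges of G).  Its degree function:
degree : ∀ {n} → List (EdgeMat n) → EdgeMat n → ℕ
degree ℋ σ = length (filter (λ h → (σ ⊆ᵇ h) ≟B true) ℋ)

{-# OPTIONS --safe #-}

-- Chop the stars of G into disjoint stars with exactly s·m leaves, split the leaves of each
-- into s parts of size m, and let A run over the transversals.  Then, for every s-set A, chop
-- the set of small stars containing A into blocks of size t·r in the same way, and let B run over the
-- transversals.  With m ≈ e/n and r ≈ k^s both steps lose only a constant factor, and every
-- choice left is uniform, so the number of copies of K_{s,t} obtained with prescribed vertices
-- in i + 1 positions of A and j + 1 positions of B is O(1/(e m^i r^j)) times the total.  From this
-- family L, choose H ⊆ L greedily subject to d(σ) ≤ q^(st − |σ|), where q ≈ k^(1+ε).  Every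
-- rejected copy contains a saturated σ, so double counting gives |H| = Ω(q^(st−1) e), and the
-- codegree condition is the greedy bound divided by |H|.
module Submission where

open import Defs
open import Data.Nat using (ℕ; zero; suc; _+_; _*_; _∸_; _^_; _≤_; _<_; z≤n; s≤s; _≟_; _≤?_; _<ᵇ_; >-nonZero)
open import Data.Nat.DivMod using (_/_; _%_; m/n*n≤m; m≡m%n+[m/n]*n; m%n<n; m≥n⇒m/n>0)
open import Data.Nat.ListAction using (sum)
open import Data.Nat.ListAction.Properties using (sum-++)
open import Data.Nat.Properties hiding (_≟_; _≤?_)
open import Data.Nat.Tactic.RingSolver using (solve-∀)
open import Data.Bool using (Bool; if_then_else_; true; false; T; _∧_; _∨_; not)
open import Data.Bool.ListAction using (and)
open import Data.Bool.Properties using () renaming (_≟_ to _≟ᵇ_)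
open import Data.Empty using (⊥-elim)
open import Data.Fin using (Fin; zero; suc; toℕ; fromℕ<)
open import Data.Fin.Properties using (any?; toℕ<n) renaming (_≟_ to _≟ᶠ_)
open import Data.Fin.Subset using (Subset; inside; outside; ∣_∣; ⊤; Nonempty) renaming (_∈_ to _∈ˢ_)
open import Data.Fin.Subset.Properties using (∣⊤∣≡n; ∈⊤; anySubset?; nonempty?; ∣p∣≤n; x∈p⇒∣p-x∣<∣p∣)
open import Data.List using (List; []; _∷_; length; map; concatMap; _++_; filter; cartesianProductWith; [_]; allFin)
open import Data.List.Membership.Propositional using (_∈_; find)
open import Data.List.Membership.Propositional.Properties using
  (∈-cartesianProductWith⁻; ∈-concatMap⁻; ∈-map⁻; ∈-filter⁺; ∈-filter⁻; ∈-allFin; ∈-++⁺ˡ; ∈-++⁺ʳ)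
open import Data.List.Properties using (map-++; map-tabulate; length-++; length-map; length-filter; length-tabulate)
open import Data.List.Relation.Unary.All as All using (All; []; _∷_)
open import Data.List.Relation.Unary.All.Properties using () renaming (map⁺ to All-map⁺)
open import Data.List.Relation.Unary.AllPairs using ([]; _∷_)
open import Data.List.Relation.Unary.Any using (here; there)
open import Data.List.Relation.Unary.Unique.Propositional using (Unique)
open import Data.Product using (Σ; ∃; ∃₂; _×_; _,_; proj₁; proj₂; swap)
open import Data.Sum using (_⊎_; inj₁; inj₂)
open import Data.Vec as Vec using (Vec; []; _∷_; lookup; toList; fromList; zipWith; here; there)
open import Data.Vec.Membership.Propositional.Properties using (∈-toList⁺; ∈-lookup)
open import Data.Vec.Properties using (toList∘fromList; length-toList; ≡-dec; lookup∘tabulate; []=⇒lookup)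
open import Function using (_∘_; id)
open import Function.Bundles using (mk⇔)
open import Relation.Binary.Definitions using (DecidableEquality)
open import Relation.Binary.PropositionalEquality hiding ([_]; J)
open import Relation.Nullary using (Dec; yes; no; does; ¬_; _×-dec_; _⊎-dec_)
open import Relation.Nullary.Decidable using (dec-true)

-- High-degree vertices are the obstacle: counting all copies of K_{s,t} would favour the edges at
-- such vertices. Pieces of equal size remove this bias, and transversals make the positions of a
-- piece independent, so prescribing one more vertex divides the count by exactly the part size.
-- Both stages are one operation on key-value pairs, `Expansion`: the keys are first the upper
-- endpoints of edges and then the s-tuples A.
--
-- The codegree bound has to pay k^(1+ε) for every edge of σ, while this count pays for vertices.
-- Once one vertex on each side is fixed, each further vertex is worth at least r, which is of order
-- k^s. So i + j further vertices are worth about k^(s(i+j)), and they add at most (i+1)(j+1) - 1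
-- edges. The slack between these two exponents is what permits a positive ε.
--
-- The number k is in general irrational, so it enters only through k^s = e^s / n^(2s-1), and all
-- roots and quotients are cleared into inequalities between natural numbers.

private
  variable
    A B W : Set
    m n R s : ℕ

-- Sums over lists

∑ : List A → (A → ℕ) → ℕ
∑ xs f = sum (map f xs)

infixr 5 ∑
syntax ∑ xs (λ x → y) = ∑[ x ← xs ] y

∑ᵛ : Vec A n → (A → ℕ) → ℕ
∑ᵛ v = ∑ (toList v)

∑-mono-∈ : ∀ (xs : List A) {f g : A → ℕ} → (∀ {x} → x ∈ xs → f x ≤ g x) → ∑ xs f ≤ ∑ xs g
∑-mono-∈ []       h = z≤n
∑-mono-∈ (x ∷ xs) h = +-mono-≤ (h (here refl)) (∑-mono-∈ xs (h ∘ there))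

∑-mono : ∀ (xs : List A) {f g : A → ℕ} → (∀ x → f x ≤ g x) → ∑ xs f ≤ ∑ xs g
∑-mono xs h = ∑-mono-∈ xs λ {x} _ → h x

∑-cong : ∀ (xs : List A) {f g : A → ℕ} → (∀ x → f x ≡ g x) → ∑ xs f ≡ ∑ xs g
∑-cong []       h = refl
∑-cong (x ∷ xs) h = cong₂ _+_ (h x) (∑-cong xs h)

∑-const : ∀ (xs : List A) c → ∑ xs (λ _ → c) ≡ length xs * c
∑-const []       c = refl
∑-const (x ∷ xs) c = cong (c +_) (∑-const xs c)

∑-≤-const : ∀ (xs : List A) {f : A → ℕ} {c} → (∀ {x} → x ∈ xs → f x ≤ c) → ∑ xs f ≤ length xs * c
∑-≤-const xs h = ≤-trans (∑-mono-∈ xs h) (≤-reflexive (∑-const xs _))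

∑-*ˡ : ∀ (xs : List A) c f → ∑ xs (λ x → c * f x) ≡ c * ∑ xs f
∑-*ˡ []       c f = sym (*-zeroʳ c)
∑-*ˡ (x ∷ xs) c f = trans (cong (c * f x +_) (∑-*ˡ xs c f)) (sym (*-distribˡ-+ c (f x) _))

∑-*ʳ : ∀ (xs : List A) c f → ∑ xs (λ x → f x * c) ≡ ∑ xs f * c
∑-*ʳ xs c f = trans (∑-cong xs λ x → *-comm (f x) c) (trans (∑-*ˡ xs c f) (*-comm c _))

∑-++ : ∀ (xs ys : List A) f → ∑ (xs ++ ys) f ≡ ∑ xs f + ∑ ys f
∑-++ xs ys f = trans (cong sum (map-++ f xs ys)) (sum-++ (map f xs) (map f ys))

∑-map : ∀ (g : A → B) xs f → ∑ (map g xs) f ≡ ∑ xs (f ∘ g)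
∑-map g []       f = refl
∑-map g (x ∷ xs) f = cong (f (g x) +_) (∑-map g xs f)

∑-concatMap : ∀ (g : A → List B) xs f → ∑ (concatMap g xs) f ≡ ∑[ x ← xs ] ∑ (g x) f
∑-concatMap g []       f = refl
∑-concatMap g (x ∷ xs) f = trans (∑-++ (g x) (concatMap g xs) f) (cong (∑ (g x) f +_) (∑-concatMap g xs f))

∑-+ : ∀ (xs : List A) f g → ∑ xs (λ x → f x + g x) ≡ ∑ xs f + ∑ xs g
∑-+ []       f g = refl
∑-+ (x ∷ xs) f g = trans (cong (f x + g x +_) (∑-+ xs f g)) (lemma (f x) (g x) (∑ xs f) (∑ xs g))
  where
  lemma : ∀ a b c d → a + b + (c + d) ≡ a + c + (b + d)
  lemma = solve-∀

∑-comm : ∀ (xs : List A) (ys : List B) (f : A → B → ℕ) →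
  (∑[ x ← xs ] ∑[ y ← ys ] f x y) ≡ (∑[ y ← ys ] ∑[ x ← xs ] f x y)
∑-comm []       ys f = sym (trans (∑-const ys 0) (*-zeroʳ (length ys)))
∑-comm (x ∷ xs) ys f = trans (cong (∑ ys (f x) +_) (∑-comm xs ys f)) (sym (∑-+ ys (f x) _))

∑-∈ : ∀ {xs : List A} {x} (f : A → ℕ) → x ∈ xs → f x ≤ ∑ xs f
∑-∈ f (here refl)  = m≤m+n _ _
∑-∈ {xs = y ∷ _} f (there x∈) = ≤-trans (∑-∈ f x∈) (m≤n+m _ (f y))

length-∑ : ∀ (xs : List A) → length xs ≡ ∑ xs (λ _ → 1)
length-∑ xs = sym (trans (∑-const xs 1) (*-identityʳ _))

∑-cartesianProductWith : ∀ {C : Set} (g : A → B → C) xs ys f →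
  ∑ (cartesianProductWith g xs ys) f ≡ ∑[ x ← xs ] ∑[ y ← ys ] f (g x y)
∑-cartesianProductWith g []       ys f = refl
∑-cartesianProductWith g (x ∷ xs) ys f =
  trans (∑-++ (map (g x) ys) _ f)
        (cong₂ _+_ (∑-map (g x) ys f) (∑-cartesianProductWith g xs ys f))

∑ᵛ-lookup : ∀ (v : Vec A n) i (f : A → ℕ) → f (lookup v i) ≤ ∑ᵛ v f
∑ᵛ-lookup (x ∷ v) zero    f = m≤m+n _ _
∑ᵛ-lookup (x ∷ v) (suc i) f = ≤-trans (∑ᵛ-lookup v i f) (m≤n+m _ (f x))

∑ᵛ-lookup₂ : ∀ (v : Vec A n) {i j} (f : A → ℕ) → i ≢ j → f (lookup v i) + f (lookup v j) ≤ ∑ᵛ v f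
∑ᵛ-lookup₂ (x ∷ v) {zero}  {zero}  f i≢j = ⊥-elim (i≢j refl)
∑ᵛ-lookup₂ (x ∷ v) {zero}  {suc j} f i≢j = +-monoʳ-≤ (f x) (∑ᵛ-lookup v j f)
∑ᵛ-lookup₂ (x ∷ v) {suc i} {zero}  f i≢j =
  ≤-trans (≤-reflexive (+-comm (f (lookup v i)) (f x))) (+-monoʳ-≤ (f x) (∑ᵛ-lookup v i f))
∑ᵛ-lookup₂ (x ∷ v) {suc i} {suc j} f i≢j =
  ≤-trans (∑ᵛ-lookup₂ v f (i≢j ∘ cong suc)) (m≤n+m _ (f x))

𝟙 : ∀ {P : Set} → Dec P → ℕ
𝟙 d = if does d then 1 else 0

𝟙-yes : ∀ {P : Set} (d : Dec P) → P → 𝟙 d ≡ 1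
𝟙-yes (yes _) p = refl
𝟙-yes (no ¬p) p = ⊥-elim (¬p p)

𝟙-mono : ∀ {P : Set} (d : Dec P) {x} → (P → 1 ≤ x) → 𝟙 d ≤ x
𝟙-mono (yes p) h = h p
𝟙-mono (no _)  h = z≤n

-- Weighted counts of transversals

module Multiplicity {W : Set} (_≟ʷ_ : DecidableEquality W) where

  mult : List W → W → ℕ
  mult vs w = ∑[ v ← vs ] 𝟙 (w ≟ʷ v)

  ∈⇒mult : ∀ {vs w} → w ∈ vs → 1 ≤ mult vs w
  ∈⇒mult {w = w} w∈ = ≤-trans (≤-reflexive (sym (𝟙-yes (w ≟ʷ w) refl))) (∑-∈ (λ v → 𝟙 (w ≟ʷ v)) w∈)

  mult⇒∈ : ∀ {vs w} → 1 ≤ mult vs w → w ∈ vs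
  mult⇒∈ {v ∷ vs} {w} h with w ≟ʷ v
  ... | yes w≡v = here w≡v
  ... | no _    = there (mult⇒∈ h)

  -- A product over the positions i ∈ I; when the V i are singletons it is an indicator.
  weight : Subset n → (Fin n → List W) → Vec W n → ℕ
  weight []            V []       = 1
  weight (inside  ∷ I) V (w ∷ ws) = mult (V zero) w * weight I (V ∘ suc) ws
  weight (outside ∷ I) V (w ∷ ws) = weight I (V ∘ suc) ws

  weight-pos : ∀ (I : Subset n) {V} ws → (∀ {i} → i ∈ˢ I → lookup ws i ∈ V i) → 1 ≤ weight I V ws
  weight-pos []            []       h = ≤-refl
  weight-pos (inside  ∷ I) (w ∷ ws) h = *-mono-≤ (∈⇒mult (h here)) (weight-pos I ws (h ∘ there))
  weight-pos (outside ∷ I) (w ∷ ws) h = weight-pos I ws (h ∘ there)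

choices : Vec (Vec W m) s → List (Vec W s)
choices []       = [] ∷ []
choices (l ∷ ls) = cartesianProductWith _∷_ (toList l) (choices ls)

length-choices : ∀ (ls : Vec (Vec W m) s) → length (choices ls) ≡ m ^ s
length-choices [] = refl
length-choices {m = m} {suc s} (l ∷ ls) = begin
  length (choices (l ∷ ls))                       ≡⟨ length-∑ (choices (l ∷ ls)) ⟩
  ∑ (choices (l ∷ ls)) (λ _ → 1)                  ≡⟨ ∑-cartesianProductWith _∷_ (toList l) _ _ ⟩
  (∑[ _ ← toList l ] ∑ (choices ls) (λ _ → 1))    ≡⟨ ∑-const (toList l) _ ⟩
  length (toList l) * ∑ (choices ls) (λ _ → 1)    ≡⟨ cong₂ _*_ (length-toList l) (trans (sym (length-∑ (choices ls))) (length-choices ls)) ⟩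
  m * m ^ s                                       ∎
  where open ≡-Reasoning

choices-∈ : ∀ (ls : Vec (Vec W m) s) {ws} → ws ∈ choices ls → ∀ i → lookup ws i ∈ toList (lookup ls i)
choices-∈ (l ∷ ls) {w ∷ ws} ws∈ i with ∈-cartesianProductWith⁻ _∷_ (toList l) (choices ls) ws∈
... | _ , _ , w∈ , ws∈′ , refl with i
...   | zero  = w∈
...   | suc i = choices-∈ ls ws∈′ i

module Choices {W : Set} (_≟ʷ_ : DecidableEquality W) where
  open Multiplicity _≟ʷ_

  private
    rearrange₁ : ∀ a b c d → a * b * (c * d) ≡ a * c * (b * d)
    rearrange₁ = solve-∀

  -- The weight is a product over positions, and a transversal chooses its entries independently, so
  -- the sum factorises. A position outside `I` contributes just its `m` choices.
  ∑-choices-∷ : ∀ (l : Vec W m) (ls : Vec (Vec W m) s) I b V →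
    ∑ (choices (l ∷ ls)) (weight (b ∷ I) V) ≡
    (if b then ∑ᵛ l (mult (V zero)) else m) * ∑ (choices ls) (weight I (V ∘ suc))
  ∑-choices-∷ l ls I inside V = trans (∑-cartesianProductWith _∷_ (toList l) (choices ls) _)
    (trans (∑-cong (toList l) λ w → ∑-*ˡ (choices ls) (mult (V zero) w) _) (∑-*ʳ (toList l) _ _))
  ∑-choices-∷ l ls I outside V = trans (∑-cartesianProductWith _∷_ (toList l) (choices ls) _)
    (trans (∑-const (toList l) _) (cong (_* _) (length-toList l)))

  module _ {c : ℕ} (1≤c : 1 ≤ c) where

    private
      part≤ : ∀ {m x} b → (b ≡ inside → x ≤ c) → (if b then x else m) * m ^ (if b then 1 else 0) ≤ c * m
      part≤ {m} inside h = *-mono-≤ (h refl) (≤-reflexive (*-identityʳ m))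
      part≤ {m} outside h = ≤-trans (≤-reflexive (*-comm m 1)) (*-monoˡ-≤ m 1≤c)

      ∣∷∣ : ∀ m b (I : Subset n) → m ^ ∣ b ∷ I ∣ ≡ m ^ (if b then 1 else 0) * m ^ ∣ I ∣
      ∣∷∣ m inside I = cong (_* m ^ ∣ I ∣) (sym (*-identityʳ m))
      ∣∷∣ m outside I = sym (*-identityˡ _)

    -- Every position accounts for at most `c * m`: inside `I` there are at most `c` hits together
    -- with one factor of `m ^ ∣ I ∣`, outside `I` there are `m` choices and `1 ≤ c`.
    ∑-choices-≤ : ∀ (ls : Vec (Vec W m) s) I V →
      (∀ i → ∑ᵛ (lookup ls i) (mult (V i)) ≤ c) →
      ∑ (choices ls) (weight I V) * m ^ ∣ I ∣ ≤ (c * m) ^ s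
    ∑-choices-≤ []       []      V h = ≤-refl
    ∑-choices-≤ {m = m} {suc s} (l ∷ ls) (b ∷ I) V h = begin
      ∑ (choices (l ∷ ls)) (weight (b ∷ I) V) * m ^ ∣ b ∷ I ∣
        ≡⟨ cong₂ _*_ (∑-choices-∷ l ls I b V) (∣∷∣ m b I) ⟩
      (if b then ∑ᵛ l (mult (V zero)) else m) * ∑ (choices ls) (weight I (V ∘ suc)) * (m ^ (if b then 1 else 0) * m ^ ∣ I ∣)
        ≡⟨ rearrange₁ (if b then ∑ᵛ l (mult (V zero)) else m) _ _ _ ⟩
      (if b then ∑ᵛ l (mult (V zero)) else m) * m ^ (if b then 1 else 0) * (∑ (choices ls) (weight I (V ∘ suc)) * m ^ ∣ I ∣)
        ≤⟨ *-mono-≤ (part≤ b λ _ → h zero) (∑-choices-≤ ls I (V ∘ suc) (h ∘ suc)) ⟩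
      c * m * (c * m) ^ s ∎
      where open ≤-Reasoning

    -- The hits in position `i` stay as a factor instead of being bounded by `c`. When this is
    -- summed over many blocks, the hits add up to those in the whole list, whereas a bound `c` for
    -- each block would cost the number of blocks.
    ∑-choices-≤-∈ : ∀ (ls : Vec (Vec W m) s) I V {i} → i ∈ˢ I →
      (∀ i → ∑ᵛ (lookup ls i) (mult (V i)) ≤ c) →
      ∑ (choices ls) (weight I V) * m ^ ∣ I ∣ ≤ (c * m) ^ s * ∑ᵛ (lookup ls i) (mult (V i))
    ∑-choices-≤-∈ {m = m} {suc s} (l ∷ ls) (inside ∷ I) V here h = begin
      ∑ (choices (l ∷ ls)) (weight (inside ∷ I) V) * m ^ ∣ inside ∷ I ∣
        ≡⟨ cong (_* m ^ ∣ inside ∷ I ∣) (∑-choices-∷ l ls I inside V) ⟩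
      x * ∑ (choices ls) (weight I (V ∘ suc)) * (m * m ^ ∣ I ∣)
        ≡⟨ rearrange₁ x _ m _ ⟩
      x * m * (∑ (choices ls) (weight I (V ∘ suc)) * m ^ ∣ I ∣)
        ≤⟨ *-monoʳ-≤ (x * m) (∑-choices-≤ ls I (V ∘ suc) (h ∘ suc)) ⟩
      x * m * (c * m) ^ s
        ≤⟨ *-monoˡ-≤ ((c * m) ^ s) (*-monoʳ-≤ x (m≤n*m m c {{>-nonZero 1≤c}})) ⟩
      x * (c * m) * (c * m) ^ s
        ≡⟨ rearrange₂ x (c * m) _ ⟩
      c * m * (c * m) ^ s * x ∎
      where
      open ≤-Reasoning
      x = ∑ᵛ l (mult (V zero))
      rearrange₂ : ∀ a b d → a * b * d ≡ b * d * a
      rearrange₂ = solve-∀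
    ∑-choices-≤-∈ {m = m} {suc s} (l ∷ ls) (b ∷ I) V {suc i} (there i∈) h = begin
      ∑ (choices (l ∷ ls)) (weight (b ∷ I) V) * m ^ ∣ b ∷ I ∣
        ≡⟨ cong₂ _*_ (∑-choices-∷ l ls I b V) (∣∷∣ m b I) ⟩
      (if b then ∑ᵛ l (mult (V zero)) else m) * ∑ (choices ls) (weight I (V ∘ suc)) * (m ^ (if b then 1 else 0) * m ^ ∣ I ∣)
        ≡⟨ rearrange₁ (if b then ∑ᵛ l (mult (V zero)) else m) _ _ _ ⟩
      (if b then ∑ᵛ l (mult (V zero)) else m) * m ^ (if b then 1 else 0) * (∑ (choices ls) (weight I (V ∘ suc)) * m ^ ∣ I ∣)
        ≤⟨ *-mono-≤ (part≤ b λ _ → h zero) (∑-choices-≤-∈ ls I (V ∘ suc) i∈ (h ∘ suc)) ⟩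
      c * m * ((c * m) ^ s * ∑ᵛ (lookup ls i) (mult (V (suc i))))
        ≡⟨ *-assoc (c * m) _ _ ⟨
      c * m * (c * m) ^ s * ∑ᵛ (lookup ls i) (mult (V (suc i))) ∎
      where open ≤-Reasoning

-- Chopping a list of key–value pairs into blocks

𝟙-⇔ : ∀ {P Q : Set} (d : Dec P) (d′ : Dec Q) → (P → Q) → (Q → P) → 𝟙 d ≡ 𝟙 d′
𝟙-⇔ (yes p) d′ f g = sym (𝟙-yes d′ (f p))
𝟙-⇔ (no ¬p) (yes q) f g = ⊥-elim (¬p (g q))
𝟙-⇔ (no ¬p) (no _)  f g = refl

𝟙-*-cong : ∀ {P : Set} (d : Dec P) {x y} → (P → x ≡ y) → 𝟙 d * x ≡ 𝟙 d * y
𝟙-*-cong (yes p) h = cong (1 *_) (h p)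
𝟙-*-cong (no _)  h = refl

-- The unfinished chunk is returned rather than dropped, so that `∑-chunk` is an exact identity,
-- from which both upper and lower bounds follow.
chunk : ∀ R → List W → List (Vec W R) × List W
chunk R []       = [] , []
chunk R (w ∷ ws) with chunk R ws
... | cs , rest with suc (length rest) ≟ R
...   | yes refl = fromList (w ∷ rest) ∷ cs , []
...   | no _     = cs , w ∷ rest

∑-chunk : ∀ R (ws : List W) φ →
  (∑[ c ← proj₁ (chunk R ws) ] ∑ᵛ c φ) + ∑ (proj₂ (chunk R ws)) φ ≡ ∑ ws φ
∑-chunk R []       φ = refl
∑-chunk R (w ∷ ws) φ with chunk R ws | ∑-chunk R ws φ
... | cs , rest | ih with suc (length rest) ≟ R
...   | yes refl = begin
  φ w + ∑ (toList (fromList rest)) φ + X + 0  ≡⟨ cong (λ l → φ w + ∑ l φ + X + 0) (toList∘fromList rest) ⟩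
  φ w + ∑ rest φ + X + 0                      ≡⟨ lemma (φ w) (∑ rest φ) X ⟩
  φ w + (X + ∑ rest φ)                        ≡⟨ cong (φ w +_) ih ⟩
  φ w + ∑ ws φ                                ∎
  where
  open ≡-Reasoning
  X = ∑[ c ← cs ] ∑ᵛ c φ
  lemma : ∀ a b x → a + b + x + 0 ≡ a + (x + b)
  lemma = solve-∀
...   | no _     = trans (lemma (φ w) (∑ rest φ) (∑[ c ← cs ] ∑ᵛ c φ)) (cong (φ w +_) ih)
  where
  lemma : ∀ a b x → x + (a + b) ≡ a + (x + b)
  lemma = solve-∀

chunk-rest-< : ∀ {R} → 0 < R → (ws : List W) → length (proj₂ (chunk R ws)) < R
chunk-rest-< 0<R [] = 0<R
chunk-rest-< {R = R} 0<R (w ∷ ws) with chunk R ws | chunk-rest-< 0<R ws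
... | cs , rest | ih with suc (length rest) ≟ R
...   | yes refl = 0<R
...   | no ≢R    = ≤∧≢⇒< ih ≢R

length-chunk : ∀ {R} → 0 < R → (ws : List W) → length ws < suc (length (proj₁ (chunk R ws))) * R
length-chunk {R = R} 0<R ws = begin-strict
  length ws                        ≡⟨ length-∑ ws ⟩
  ∑ ws (λ _ → 1)                   ≡⟨ ∑-chunk R ws (λ _ → 1) ⟨
  (∑[ c ← cs ] ∑ᵛ c (λ _ → 1)) + ∑ rest (λ _ → 1)
    ≡⟨ cong₂ _+_ (trans (∑-cong cs λ c → trans (sym (length-∑ (toList c))) (length-toList c)) (∑-const cs R)) (sym (length-∑ rest)) ⟩
  length cs * R + length rest      <⟨ +-monoʳ-< (length cs * R) (chunk-rest-< 0<R ws) ⟩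
  length cs * R + R                ≡⟨ +-comm _ R ⟩
  suc (length cs) * R              ∎
  where
  open ≤-Reasoning
  cs = proj₁ (chunk R ws)
  rest = proj₂ (chunk R ws)

-- The inner chunking makes parts of `m` values, the outer one groups `s` parts into a block. For
-- positive `s` and `m`, fewer than `s * m` values are lost.
blocks : ∀ s m → List W → List (Vec (Vec W m) s)
blocks s m ws = proj₁ (chunk s (proj₁ (chunk m ws)))

∑-blocks : ∀ s m (ws : List W) φ → (∑[ β ← blocks s m ws ] ∑ᵛ β (λ l → ∑ᵛ l φ)) ≤ ∑ ws φ
∑-blocks s m ws φ = ≤-trans
  (≤-trans (m≤m+n _ _) (≤-reflexive (∑-chunk s (proj₁ (chunk m ws)) (λ l → ∑ᵛ l φ))))
  (≤-trans (m≤m+n _ _) (≤-reflexive (∑-chunk m ws φ)))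

length-blocks : 0 < s → 0 < m → (ws : List W) →
  length ws ≤ length (blocks s m ws) * (s * m) + s * m
length-blocks {s = s} {m = m} 0<s 0<m ws = begin
  length ws                              ≤⟨ <⇒≤ (length-chunk 0<m ws) ⟩
  suc (length (proj₁ (chunk m ws))) * m  ≤⟨ *-monoˡ-≤ m (length-chunk 0<s (proj₁ (chunk m ws))) ⟩
  suc b * s * m                          ≡⟨ lemma b s m ⟩
  b * (s * m) + s * m                    ∎
  where
  open ≤-Reasoning
  b = length (blocks s m ws)
  lemma : ∀ b s m → (1 + b) * s * m ≡ b * (s * m) + s * m
  lemma = solve-∀

-- In the first use the pairs are edges, with the upper endpoint as key; in the second they are the
-- small stars, with the leaf tuple A as key and the centre as value. Since `ks` lists each key
-- exactly once, a sum over pairs can be regrouped by key without error.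
module Expansion {K W : Set} (_≟ᵏ_ : DecidableEquality K) (_≟ʷ_ : DecidableEquality W)
  (ks : List K) (ks-once : ∀ k → Multiplicity.mult _≟ᵏ_ ks k ≡ 1)
  {s : ℕ} (i₀ : Fin s) {m : ℕ} (0<m : 0 < m) (xs : List (K × W)) where

  open Multiplicity _≟ʷ_
  open Choices _≟ʷ_

  private
    0<s : ∀ {s} → Fin s → 0 < s
    0<s zero    = s≤s z≤n
    0<s (suc _) = s≤s z≤n

  values : K → List W
  values k = map proj₂ (filter (λ x → proj₁ x ≟ᵏ k) xs)

  ∑-values : ∀ k φ → ∑ (values k) φ ≡ ∑[ x ← xs ] 𝟙 (proj₁ x ≟ᵏ k) * φ (proj₂ x)
  ∑-values k φ = trans (∑-map proj₂ (filter (λ x → proj₁ x ≟ᵏ k) xs) φ) (go xs)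
    where
    go : ∀ ys → ∑ (filter (λ x → proj₁ x ≟ᵏ k) ys) (φ ∘ proj₂) ≡ ∑[ x ← ys ] 𝟙 (proj₁ x ≟ᵏ k) * φ (proj₂ x)
    go [] = refl
    go (y ∷ ys) with proj₁ y ≟ᵏ k
    ... | yes _ = cong₂ _+_ (sym (*-identityˡ _)) (go ys)
    ... | no _  = go ys

  ∑-∑-values : ∀ (φ : K → W → ℕ) → (∑[ k ← ks ] ∑ (values k) (φ k)) ≡ ∑[ x ← xs ] φ (proj₁ x) (proj₂ x)
  ∑-∑-values φ = begin
    (∑[ k ← ks ] ∑ (values k) (φ k))
      ≡⟨ ∑-cong ks (λ k → ∑-values k (φ k)) ⟩
    (∑[ k ← ks ] ∑[ x ← xs ] 𝟙 (proj₁ x ≟ᵏ k) * φ k (proj₂ x))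
      ≡⟨ ∑-comm ks xs _ ⟩
    (∑[ x ← xs ] ∑[ k ← ks ] 𝟙 (proj₁ x ≟ᵏ k) * φ k (proj₂ x))
      ≡⟨ ∑-cong xs (λ x → trans
           (∑-cong ks λ k → 𝟙-*-cong (proj₁ x ≟ᵏ k) λ eq → cong (λ k → φ k (proj₂ x)) (sym eq))
           (trans (∑-*ʳ ks _ _) (trans (cong (_* φ (proj₁ x) (proj₂ x)) (ks-once (proj₁ x))) (*-identityˡ _)))) ⟩
    (∑[ x ← xs ] φ (proj₁ x) (proj₂ x)) ∎
    where open ≡-Reasoning

  expand : List (K × Vec W s)
  expand = concatMap (λ k → map (k ,_) (concatMap choices (blocks s m (values k)))) ks

  ∑-expand : ∀ φ → ∑ expand φ ≡ ∑[ k ← ks ] ∑[ β ← blocks s m (values k) ] ∑[ ws ← choices β ] φ (k , ws)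
  ∑-expand φ = trans (∑-concatMap _ ks φ) (∑-cong ks λ k →
    trans (∑-map (k ,_) (concatMap choices (blocks s m (values k))) φ) (∑-concatMap choices (blocks s m (values k)) _))

  ∑-expand-blocks : ∀ (φ : K → W → ℕ) →
    (∑[ k ← ks ] ∑[ β ← blocks s m (values k) ] ∑ᵛ β (λ l → ∑ᵛ l (φ k))) ≤ ∑[ x ← xs ] φ (proj₁ x) (proj₂ x)
  ∑-expand-blocks φ = ≤-trans (∑-mono ks λ k → ∑-blocks s m (values k) (φ k)) (≤-reflexive (∑-∑-values φ))

  numBlocks : ℕ
  numBlocks = ∑[ k ← ks ] length (blocks s m (values k))

  length-expand : length expand ≡ numBlocks * m ^ s
  length-expand = begin
    length expand ≡⟨ length-∑ expand ⟩
    ∑ expand (λ _ → 1) ≡⟨ ∑-expand _ ⟩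
    (∑[ k ← ks ] ∑[ β ← blocks s m (values k) ] ∑ (choices β) (λ _ → 1))
      ≡⟨ ∑-cong ks (λ k → trans
           (∑-cong (blocks s m (values k)) λ β → trans (sym (length-∑ (choices β))) (length-choices β))
           (∑-const (blocks s m (values k)) (m ^ s))) ⟩
    (∑[ k ← ks ] length (blocks s m (values k)) * m ^ s) ≡⟨ ∑-*ʳ ks (m ^ s) _ ⟩
    numBlocks * m ^ s ∎
    where open ≡-Reasoning

  -- Each key loses at most `s * m` values. This dictates the later choice of part sizes: the total
  -- loss must be at most half of the list.
  length-≤-numBlocks : length xs ≤ numBlocks * (s * m) + length ks * (s * m)
  length-≤-numBlocks = begin
    length xs                         ≡⟨ length-∑ xs ⟩
    ∑ xs (λ _ → 1)                    ≡⟨ ∑-∑-values (λ _ _ → 1) ⟨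
    (∑[ k ← ks ] ∑ (values k) (λ _ → 1))
      ≤⟨ ∑-mono ks (λ k → ≤-trans (≤-reflexive (sym (length-∑ (values k)))) (length-blocks (0<s i₀) 0<m (values k))) ⟩
    (∑[ k ← ks ] length (blocks s m (values k)) * (s * m) + s * m)
      ≡⟨ ∑-+ ks _ _ ⟩
    (∑[ k ← ks ] length (blocks s m (values k)) * (s * m)) + ∑ ks (λ _ → s * m)
      ≡⟨ cong₂ _+_ (∑-*ʳ ks (s * m) _) (∑-const ks (s * m)) ⟩
    numBlocks * (s * m) + length ks * (s * m) ∎
    where open ≤-Reasoning

  numBlocks-≤-length : numBlocks * (s * m) ≤ length xs
  numBlocks-≤-length = begin
    numBlocks * (s * m) ≡⟨ ∑-*ʳ ks (s * m) _ ⟨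
    (∑[ k ← ks ] length (blocks s m (values k)) * (s * m))
      ≡⟨ ∑-cong ks (λ k → trans (sym (∑-const (blocks s m (values k)) (s * m))) (∑-cong (blocks s m (values k)) λ β → sym (size β))) ⟩
    (∑[ k ← ks ] ∑[ β ← blocks s m (values k) ] ∑ᵛ β (λ l → ∑ᵛ l (λ _ → 1)))
      ≤⟨ ∑-expand-blocks (λ _ _ → 1) ⟩
    ∑ xs (λ _ → 1) ≡⟨ length-∑ xs ⟨
    length xs ∎
    where
    open ≤-Reasoning
    size : ∀ (β : Vec (Vec W m) s) → ∑ᵛ β (λ l → ∑ᵛ l (λ _ → 1)) ≡ s * m
    size β = trans (∑-cong (toList β) λ l → trans (sym (length-∑ (toList l))) (length-toList l))
      (trans (∑-const (toList β) m) (cong (_* m) (length-toList β)))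

  ∑-block-≤ : ∀ {k β} → β ∈ blocks s m (values k) → ∀ φ → ∑ᵛ β (λ l → ∑ᵛ l φ) ≤ ∑ (values k) φ
  ∑-block-≤ β∈ φ = ≤-trans (∑-∈ (λ β → ∑ᵛ β (λ l → ∑ᵛ l φ)) β∈) (∑-blocks s m (values _) φ)

  ∈-expand⁻ : ∀ {k ws} → (k , ws) ∈ expand → ∃ λ β → β ∈ blocks s m (values k) × ws ∈ choices β
  ∈-expand⁻ y∈ with find (∈-concatMap⁻ _ {xs = ks} y∈)
  ... | k , _ , y∈′ with ∈-map⁻ (k ,_) y∈′
  ...   | ws , ws∈ , refl with find (∈-concatMap⁻ choices {xs = blocks s m (values k)} ws∈)
  ...     | β , β∈ , ws∈β = β , β∈ , ws∈β

  -- The blocks are controlled only through sums, so membership is recovered from multiplicities: a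
  -- value that occurs in some part occurs at least once among the values of its key.
  expand-entry : ∀ {k ws} → (k , ws) ∈ expand → ∀ i → (k , lookup ws i) ∈ xs
  expand-entry {k} {ws} y∈ i with ∈-expand⁻ y∈
  ... | β , β∈ , ws∈ with ∈-map⁻ proj₂ (mult⇒∈ (begin
        1                                               ≤⟨ ∈⇒mult (choices-∈ β ws∈ i) ⟩
        mult (toList (lookup β i)) (lookup ws i)        ≤⟨ ∑ᵛ-lookup β i (λ l → ∑ᵛ l φ) ⟩
        ∑ᵛ β (λ l → ∑ᵛ l φ)                             ≤⟨ ∑-block-≤ β∈ φ ⟩
        mult (values k) (lookup ws i)                   ∎))
    where
    open ≤-Reasoning
    φ : W → ℕ
    φ w = 𝟙 (lookup ws i ≟ʷ w)
  ...   | (k′ , w) , x∈ , refl with ∈-filter⁻ (λ x → proj₁ x ≟ᵏ k) x∈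
  ...     | x∈xs , refl = x∈xs

  module _ (simple : ∀ k w → (∑[ x ← xs ] 𝟙 (proj₁ x ≟ᵏ k) * 𝟙 (proj₂ x ≟ʷ w)) ≤ 1) where

    -- Different positions draw on disjoint stretches of the values of `k`, so a repeated entry
    -- would be a pair occurring twice in `xs`.
    expand-injective : ∀ {k ws} → (k , ws) ∈ expand → ∀ {i j} → lookup ws i ≡ lookup ws j → i ≡ j
    expand-injective {k} {ws} y∈ {i} {j} eq with i ≟ᶠ j
    ... | yes i≡j = i≡j
    ... | no  i≢j with ∈-expand⁻ y∈
    ...   | β , β∈ , ws∈ = ⊥-elim (<-irrefl refl (begin
        1 + 1 ≤⟨ +-mono-≤ (∈⇒mult (choices-∈ β ws∈ i)) (∈⇒mult (subst (_∈ toList (lookup β j)) (sym eq) (choices-∈ β ws∈ j))) ⟩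
        mult (toList (lookup β i)) w + mult (toList (lookup β j)) w ≤⟨ ∑ᵛ-lookup₂ β (λ l → ∑ᵛ l φ) i≢j ⟩
        ∑ᵛ β (λ l → ∑ᵛ l φ) ≤⟨ ∑-block-≤ β∈ φ ⟩
        ∑ (values k) φ ≡⟨ ∑-values k φ ⟩
        (∑[ x ← xs ] 𝟙 (proj₁ x ≟ᵏ k) * 𝟙 (w ≟ʷ proj₂ x))
          ≡⟨ ∑-cong xs (λ x → cong (𝟙 (proj₁ x ≟ᵏ k) *_) (𝟙-⇔ (w ≟ʷ proj₂ x) (proj₂ x ≟ʷ w) sym sym)) ⟩
        (∑[ x ← xs ] 𝟙 (proj₁ x ≟ᵏ k) * 𝟙 (proj₂ x ≟ʷ w)) ≤⟨ simple k w ⟩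
        1 ∎))
      where
      open ≤-Reasoning
      w = lookup ws i
      φ : W → ℕ
      φ w′ = 𝟙 (w ≟ʷ w′)

    ∑-part-≤ : ∀ {k β} → β ∈ blocks s m (values k) → ∀ i V → ∑ᵛ (lookup β i) (mult V) ≤ length V
    ∑-part-≤ {k} {β} β∈ i V = begin
      ∑ᵛ (lookup β i) (mult V) ≤⟨ ∑ᵛ-lookup β i (λ l → ∑ᵛ l (mult V)) ⟩
      ∑ᵛ β (λ l → ∑ᵛ l (mult V)) ≤⟨ ∑-block-≤ β∈ (mult V) ⟩
      ∑ (values k) (mult V) ≡⟨ ∑-values k (mult V) ⟩
      (∑[ x ← xs ] 𝟙 (proj₁ x ≟ᵏ k) * mult V (proj₂ x)) ≡⟨ ∑-cong xs (λ x → sym (∑-*ˡ V (𝟙 (proj₁ x ≟ᵏ k)) _)) ⟩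
      (∑[ x ← xs ] ∑[ v ← V ] 𝟙 (proj₁ x ≟ᵏ k) * 𝟙 (proj₂ x ≟ʷ v)) ≡⟨ ∑-comm xs V _ ⟩
      (∑[ v ← V ] ∑[ x ← xs ] 𝟙 (proj₁ x ≟ᵏ k) * 𝟙 (proj₂ x ≟ʷ v)) ≤⟨ ∑-≤-const V (λ {v} _ → simple k v) ⟩
      length V * 1 ≡⟨ *-identityʳ _ ⟩
      length V ∎
      where open ≤-Reasoning

    -- This is the loss-free half of each stage. Position `i` is charged to the original pairs, each
    -- of which is used by at most one block; the other positions are bounded inside the block. The
    -- factor `χ` carries along any weight that depends on the key.
    expand-weight : ∀ {c} → 1 ≤ c → ∀ (I : Subset s) {V} → (∀ i → length (V i) ≤ c) → ∀ {i} → i ∈ˢ I → (χ : K → ℕ) →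
      (∑[ y ← expand ] χ (proj₁ y) * weight I V (proj₂ y)) * m ^ ∣ I ∣
        ≤ (c * m) ^ s * (∑[ x ← xs ] χ (proj₁ x) * mult (V i) (proj₂ x))
    expand-weight {c} 1≤c I {V} V≤c {i} i∈I χ = begin
      (∑[ y ← expand ] χ (proj₁ y) * weight I V (proj₂ y)) * m ^ ∣ I ∣
        ≡⟨ cong (_* m ^ ∣ I ∣) (∑-expand _) ⟩
      (∑[ k ← ks ] ∑[ β ← bs k ] ∑[ ws ← choices β ] χ k * weight I V ws) * m ^ ∣ I ∣
        ≡⟨ ∑-*ʳ ks _ _ ⟨
      (∑[ k ← ks ] (∑[ β ← bs k ] ∑[ ws ← choices β ] χ k * weight I V ws) * m ^ ∣ I ∣)
        ≡⟨ ∑-cong ks (λ k → sym (∑-*ʳ (bs k) _ _)) ⟩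
      (∑[ k ← ks ] ∑[ β ← bs k ] (∑[ ws ← choices β ] χ k * weight I V ws) * m ^ ∣ I ∣)
        ≤⟨ ∑-mono ks (λ k → ∑-mono-∈ (bs k) (perBlock k)) ⟩
      (∑[ k ← ks ] ∑[ β ← bs k ] (c * m) ^ s * ∑ᵛ β (λ l → ∑ᵛ l (λ w → χ k * mult (V i) w)))
        ≡⟨ ∑-cong ks (λ k → ∑-*ˡ (bs k) ((c * m) ^ s) _) ⟩
      (∑[ k ← ks ] (c * m) ^ s * (∑[ β ← bs k ] ∑ᵛ β (λ l → ∑ᵛ l (λ w → χ k * mult (V i) w))))
        ≡⟨ ∑-*ˡ ks ((c * m) ^ s) _ ⟩
      (c * m) ^ s * (∑[ k ← ks ] ∑[ β ← bs k ] ∑ᵛ β (λ l → ∑ᵛ l (λ w → χ k * mult (V i) w)))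
        ≤⟨ *-monoʳ-≤ ((c * m) ^ s) (∑-expand-blocks (λ k w → χ k * mult (V i) w)) ⟩
      (c * m) ^ s * (∑[ x ← xs ] χ (proj₁ x) * mult (V i) (proj₂ x)) ∎
      where
      open ≤-Reasoning
      bs : K → List (Vec (Vec W m) s)
      bs k = blocks s m (values k)
      rearrange : ∀ a b d → a * (b * d) ≡ b * (a * d)
      rearrange = solve-∀
      perBlock : ∀ k {β} → β ∈ bs k → (∑[ ws ← choices β ] χ k * weight I V ws) * m ^ ∣ I ∣
        ≤ (c * m) ^ s * ∑ᵛ β (λ l → ∑ᵛ l (λ w → χ k * mult (V i) w))
      perBlock k {β} β∈ = begin
        (∑[ ws ← choices β ] χ k * weight I V ws) * m ^ ∣ I ∣
          ≡⟨ cong (_* m ^ ∣ I ∣) (∑-*ˡ (choices β) (χ k) _) ⟩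
        χ k * ∑ (choices β) (weight I V) * m ^ ∣ I ∣
          ≡⟨ *-assoc (χ k) _ _ ⟩
        χ k * (∑ (choices β) (weight I V) * m ^ ∣ I ∣)
          ≤⟨ *-monoʳ-≤ (χ k) (∑-choices-≤-∈ 1≤c β I V i∈I λ i → ≤-trans (∑-part-≤ β∈ i (V i)) (V≤c i)) ⟩
        χ k * ((c * m) ^ s * ∑ᵛ (lookup β i) (mult (V i)))
          ≡⟨ rearrange (χ k) ((c * m) ^ s) _ ⟩
        (c * m) ^ s * (χ k * ∑ᵛ (lookup β i) (mult (V i)))
          ≡⟨ cong ((c * m) ^ s *_) (∑-*ˡ (toList (lookup β i)) (χ k) _) ⟨
        (c * m) ^ s * ∑ᵛ (lookup β i) (λ w → χ k * mult (V i) w)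
          ≤⟨ *-monoʳ-≤ ((c * m) ^ s) (∑ᵛ-lookup β i (λ l → ∑ᵛ l (λ w → χ k * mult (V i) w))) ⟩
        (c * m) ^ s * ∑ᵛ β (λ l → ∑ᵛ l (λ w → χ k * mult (V i) w)) ∎

    -- The case `I = ⊤`, singleton lists and `c = 1` of `expand-weight`, in which `m ^ s` cancels.
    -- It gives the output the property required of the input, so that a second expansion is
    -- possible.
    expand-simple : ∀ k ws → (∑[ y ← expand ] 𝟙 (proj₁ y ≟ᵏ k) * 𝟙 (≡-dec _≟ʷ_ (proj₂ y) ws)) ≤ 1
    expand-simple k ws = *-cancelʳ-≤ _ 1 (m ^ ∣ ⊤ {s} ∣) {{m^n≢0 m ∣ ⊤ {s} ∣ {{>-nonZero 0<m}}}} (begin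
      (∑[ y ← expand ] 𝟙 (proj₁ y ≟ᵏ k) * 𝟙 (≡-dec _≟ʷ_ (proj₂ y) ws)) * m ^ ∣ ⊤ {s} ∣
        ≤⟨ *-monoˡ-≤ (m ^ ∣ ⊤ {s} ∣) (∑-mono expand λ y → *-monoʳ-≤ (𝟙 (proj₁ y ≟ᵏ k))
             (𝟙-mono (≡-dec _≟ʷ_ (proj₂ y) ws) {weight ⊤ (λ i → [ lookup ws i ]) (proj₂ y)} λ eq →
               weight-pos ⊤ {λ i → [ lookup ws i ]} (proj₂ y) λ {i} _ → here (cong (λ v → lookup v i) eq))) ⟩
      (∑[ y ← expand ] 𝟙 (proj₁ y ≟ᵏ k) * weight ⊤ (λ i → [ lookup ws i ]) (proj₂ y)) * m ^ ∣ ⊤ {s} ∣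
        ≤⟨ expand-weight {1} (s≤s z≤n) ⊤ {λ i → [ lookup ws i ]} (λ _ → ≤-refl) (∈⊤ {x = i₀}) (λ k′ → 𝟙 (k′ ≟ᵏ k)) ⟩
      (1 * m) ^ s * (∑[ x ← xs ] 𝟙 (proj₁ x ≟ᵏ k) * (𝟙 (proj₂ x ≟ʷ lookup ws i₀) + 0))
        ≡⟨ cong₂ _*_ (cong (_^ s) (*-identityˡ m)) (∑-cong xs λ x → cong (𝟙 (proj₁ x ≟ᵏ k) *_) (+-identityʳ _)) ⟩
      m ^ s * (∑[ x ← xs ] 𝟙 (proj₁ x ≟ᵏ k) * 𝟙 (proj₂ x ≟ʷ lookup ws i₀))
        ≤⟨ *-monoʳ-≤ (m ^ s) (simple k (lookup ws i₀)) ⟩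
      m ^ s * 1
        ≡⟨ trans (*-comm (m ^ s) 1) (cong (λ j → 1 * m ^ j) (sym (∣⊤∣≡n s))) ⟩
      1 * m ^ ∣ ⊤ {s} ∣ ∎)
      where open ≤-Reasoning

-- Bicliques and the greedy subfamily

∑-allFin-suc : ∀ (f : Fin (suc n) → ℕ) → ∑ (allFin (suc n)) f ≡ f zero + ∑ (allFin n) (f ∘ suc)
∑-allFin-suc {n} f = cong (f zero +_)
  (trans (cong (λ l → ∑ l f) (sym (map-tabulate {n = n} id suc))) (∑-map suc (allFin n) f))

allFin-once : ∀ (k : Fin n) → Multiplicity.mult _≟ᶠ_ (allFin n) k ≡ 1
allFin-once {suc n} zero = trans (∑-allFin-suc {n} (λ v → 𝟙 (zero ≟ᶠ v)))
  (cong suc (trans (∑-const (allFin n) 0) (*-zeroʳ (length (allFin n)))))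
allFin-once {suc n} (suc k) = trans (∑-allFin-suc {n} (λ v → 𝟙 (suc k ≟ᶠ v)))
  (trans (∑-cong (allFin n) λ v → 𝟙-⇔ (suc k ≟ᶠ suc v) (k ≟ᶠ v) (λ { refl → refl }) (cong suc))
         (allFin-once k))

vecs : List W → ∀ s → List (Vec W s)
vecs ws s = choices (Vec.replicate s (fromList ws))

length-vecs : ∀ (ws : List W) s → length (vecs ws s) ≡ length ws ^ s
length-vecs ws s = length-choices (Vec.replicate s (fromList ws))

vecs-once : ∀ (_≟_ : DecidableEquality W) (ws : List W) → (∀ w → Multiplicity.mult _≟_ ws w ≡ 1) →
  ∀ {s} (v : Vec W s) → Multiplicity.mult (≡-dec _≟_) (vecs ws s) v ≡ 1
vecs-once _≟_ ws once []      = refl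
vecs-once _≟_ ws once {suc s} (w ∷ v) = begin
  mult′ (vecs ws (suc s)) (w ∷ v)
    ≡⟨ ∑-cartesianProductWith _∷_ (toList (fromList ws)) (vecs ws s) _ ⟩
  (∑[ x ← toList (fromList ws) ] ∑[ y ← vecs ws s ] 𝟙 (≡-dec _≟_ (w ∷ v) (x ∷ y)))
    ≡⟨ ∑-cong (toList (fromList ws)) (λ x → ∑-cong (vecs ws s) λ y → 𝟙-∷ x y) ⟩
  (∑[ x ← toList (fromList ws) ] ∑[ y ← vecs ws s ] 𝟙 (w ≟ x) * 𝟙 (≡-dec _≟_ v y))
    ≡⟨ ∑-cong (toList (fromList ws)) (λ x → trans (∑-*ˡ (vecs ws s) (𝟙 (w ≟ x)) _)
         (trans (cong (𝟙 (w ≟ x) *_) (vecs-once _≟_ ws once v)) (*-identityʳ _))) ⟩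
  (∑[ x ← toList (fromList ws) ] 𝟙 (w ≟ x))
    ≡⟨ cong (λ l → ∑ l (λ x → 𝟙 (w ≟ x))) (toList∘fromList ws) ⟩
  (∑[ x ← ws ] 𝟙 (w ≟ x))
    ≡⟨ once w ⟩
  1 ∎
  where
  open ≡-Reasoning
  mult′ : ∀ {s} → List (Vec _ s) → Vec _ s → ℕ
  mult′ = Multiplicity.mult (≡-dec _≟_)
  𝟙-∷ : ∀ x y → 𝟙 (≡-dec _≟_ (w ∷ v) (x ∷ y)) ≡ 𝟙 (w ≟ x) * 𝟙 (≡-dec _≟_ v y)
  𝟙-∷ x y with w ≟ x | ≡-dec _≟_ v y
  ... | yes _ | yes _ = refl
  ... | yes _ | no _  = refl
  ... | no _  | yes _ = refl
  ... | no _  | no _  = refl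

subsets : ∀ s → List (Subset s)
subsets = vecs (true ∷ false ∷ [])

∈-subsets : ∀ (I : Subset s) → I ∈ subsets s
∈-subsets I = Multiplicity.mult⇒∈ (≡-dec _≟ᵇ_) (≤-reflexive (sym (vecs-once _≟ᵇ_ _ (λ { true → refl ; false → refl }) I)))

does⁻ : ∀ {P : Set} (d : Dec P) → does d ≡ true → P
does⁻ (yes p) _ = p

numEdges-≤ : ∀ (σ : EdgeMat n) → numEdges σ ≤ n * n
numEdges-≤ {n} σ = begin
  numEdges σ ≤⟨ ∑-≤-const (allFin n) {c = n} (λ {u} _ →
    ≤-trans (∑-≤-const (allFin n) {c = 1} (λ {v} _ → if≤1 ((toℕ u <ᵇ toℕ v) ∧ adj σ u v)))
            (≤-reflexive (trans (*-identityʳ _) (length-tabulate {n = n} id)))) ⟩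
  length (allFin n) * n ≡⟨ cong (_* n) (length-tabulate {n = n} id) ⟩
  n * n ∎
  where
  open ≤-Reasoning
  if≤1 : ∀ b → (if b then 1 else 0) ≤ 1
  if≤1 true  = ≤-refl
  if≤1 false = z≤n

∧-true : ∀ a b → a ∧ b ≡ true → a ≡ true × b ≡ true
∧-true true true _ = refl , refl

⊆ᵇ⇒⊆ : ∀ (σ h : EdgeMat n) → (σ ⊆ᵇ h) ≡ true → σ ⊆ h
⊆ᵇ⇒⊆ σ h σ⊆h u v σuv = ∨⁻ (adj σ u v) (adj h u v)
  (rows (lookup σ u) (lookup h u) (rows σ h σ⊆h u) v) σuv
  where
  rows : ∀ {A : Set} {m} {f : A → A → Bool} (xs ys : Vec A m) →
    and (toList (zipWith f xs ys)) ≡ true → ∀ i → f (lookup xs i) (lookup ys i) ≡ true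
  rows (x ∷ xs) (y ∷ ys) eq zero    = proj₁ (∧-true _ _ eq)
  rows (x ∷ xs) (y ∷ ys) eq (suc i) = rows xs ys (proj₂ (∧-true _ _ eq)) i
  ∨⁻ : ∀ a b → not a ∨ b ≡ true → a ≡ true → b ≡ true
  ∨⁻ true true _ _ = refl

degree-∷ : ∀ (h : EdgeMat n) ℋ σ →
  degree (h ∷ ℋ) σ ≡ 𝟙 ((σ ⊆ᵇ h) ≟ᵇ true) + degree ℋ σ
degree-∷ h ℋ σ with (σ ⊆ᵇ h) ≟ᵇ true
... | yes _ = refl
... | no _  = refl

∣∣-∑ : ∀ (I : Subset s) → ∣ I ∣ ≡ ∑[ i ← allFin s ] (if lookup I i then 1 else 0)
∣∣-∑ [] = refl
∣∣-∑ {suc s} (b ∷ I) = trans (cons b) (trans (cong ((if b then 1 else 0) +_) (∣∣-∑ I))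
  (sym (∑-allFin-suc {s} (λ i → if lookup (b ∷ I) i then 1 else 0))))
  where
  cons : ∀ b → ∣ b ∷ I ∣ ≡ (if b then 1 else 0) + ∣ I ∣
  cons true  = refl
  cons false = refl

∣∣>0⇒Nonempty : ∀ (I : Subset s) → 0 < ∣ I ∣ → Nonempty I
∣∣>0⇒Nonempty (inside  ∷ I) _ = zero , Vec.here
∣∣>0⇒Nonempty (outside ∷ I) h with ∣∣>0⇒Nonempty I h
... | i , i∈I = suc i , Vec.there i∈I

-- An embedded K_{s,t}, given by the ordered tuples of the vertices of its two sides.
Biclique : ℕ → ℕ → ℕ → Set
Biclique n s t = Vec (Fin n) s × Vec (Fin n) t

module _ {n s t : ℕ} where

  open Multiplicity (_≟ᶠ_ {n})

  Joined : Biclique n s t → Fin n → Fin n → Set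
  Joined (A , B) u v = ∃₂ λ i j → (u ≡ lookup A i × v ≡ lookup B j) ⊎ (u ≡ lookup B j × v ≡ lookup A i)

  joined? : ∀ x u v → Dec (Joined x u v)
  joined? (A , B) u v = any? λ i → any? λ j →
    ((u ≟ᶠ lookup A i) ×-dec (v ≟ᶠ lookup B j)) ⊎-dec ((u ≟ᶠ lookup B j) ×-dec (v ≟ᶠ lookup A i))

  edgeSet : Biclique n s t → EdgeMat n
  edgeSet x = Vec.tabulate λ u → Vec.tabulate λ v → does (joined? x u v)

  adj-edgeSet : ∀ x u v → adj (edgeSet x) u v ≡ does (joined? x u v)
  adj-edgeSet x u v = trans (cong (λ r → lookup r v) (lookup∘tabulate _ u)) (lookup∘tabulate _ v)

  adj-edgeSet⁻ : ∀ x u v → adj (edgeSet x) u v ≡ true → Joined x u v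
  adj-edgeSet⁻ x u v eq = does⁻ (joined? x u v) (trans (sym (adj-edgeSet x u v)) eq)

  adj-edgeSet⁺ : ∀ x u v → Joined x u v → adj (edgeSet x) u v ≡ true
  adj-edgeSet⁺ x u v j = trans (adj-edgeSet x u v) (dec-true (joined? x u v) j)

  vertices : Biclique n s t → List (Fin n)
  vertices (A , B) = toList A ++ toList B

  length-vertices : ∀ x → length (vertices x) ≡ s + t
  length-vertices (A , B) = trans (length-++ (toList A)) (cong₂ _+_ (length-toList A) (length-toList B))

  edge-vertex : ∀ x u v → adj (edgeSet x) u v ≡ true → u ∈ vertices x
  edge-vertex x@(A , B) u v eq with adj-edgeSet⁻ x u v eq
  ... | i , j , inj₁ (refl , _) = ∈-++⁺ˡ (∈-toList⁺ (∈-lookup i A))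
  ... | i , j , inj₂ (refl , _) = ∈-++⁺ʳ (toList A) (∈-toList⁺ (∈-lookup j B))

  -- Every position is compared with all vertices of `h`, because a common subgraph may sit in
  -- different positions of the two copies.
  sharing : Subset s → Subset t → Biclique n s t → Biclique n s t → ℕ
  sharing I J h (A , B) = weight I (λ _ → vertices h) A * weight J (λ _ → vertices h) B

  -- Dominates the number of h ∈ H containing all the vertices of x in the positions I and J.
  codegree : Subset s → Subset t → List (Biclique n s t) → Biclique n s t → ℕ
  codegree I J H x = ∑[ h ← H ] sharing I J h x

  touched : ∀ {k} → EdgeMat n → Vec (Fin n) k → Subset k
  touched σ A = Vec.tabulate λ i → does (any? λ v → adj σ (lookup A i) v ≟ᵇ true)

  touched⁻ : ∀ {k} σ (A : Vec (Fin n) k) {i} → i ∈ˢ touched σ A → ∃ λ v → adj σ (lookup A i) v ≡ true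
  touched⁻ σ A {i} i∈ = does⁻ (any? _) (trans (sym (lookup∘tabulate _ i)) ([]=⇒lookup i∈))

  touched⁺ : ∀ {k} σ (A : Vec (Fin n) k) {i v} → adj σ (lookup A i) v ≡ true → lookup (touched σ A) i ≡ true
  touched⁺ σ A {i} {v} eq = trans (lookup∘tabulate _ i) (dec-true (any? _) (v , eq))

  sharing-touched : ∀ σ h A B → σ ⊆ edgeSet h → 1 ≤ sharing (touched σ A) (touched σ B) h (A , B)
  sharing-touched σ h A B σ⊆h = *-mono-≤ (side A) (side B)
    where
    side : ∀ {k} (A : Vec (Fin n) k) → 1 ≤ weight (touched σ A) (λ _ → vertices h) A
    side A = weight-pos (touched σ A) A λ {i} i∈ →
      let v , eq = touched⁻ σ A i∈ in edge-vertex h (lookup A i) v (σ⊆h _ v eq)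

  -- A copy that contains σ contains each vertex touched by σ, hence has weight at least 1 on the
  -- touched positions of (A , B).
  degree≤codegree : ∀ σ H A B →
    degree (map edgeSet H) σ ≤ codegree (touched σ A) (touched σ B) H (A , B)
  degree≤codegree σ []      A B = z≤n
  degree≤codegree σ (h ∷ H) A B = ≤-trans (≤-reflexive (degree-∷ (edgeSet h) (map edgeSet H) σ))
    (+-mono-≤ (𝟙-mono ((σ ⊆ᵇ edgeSet h) ≟ᵇ true) λ σ⊆h → sharing-touched σ h A B (⊆ᵇ⇒⊆ σ (edgeSet h) σ⊆h))
              (degree≤codegree σ H A B))

  Ordered : Biclique n s t → Set
  Ordered (A , B) = ∀ i j → toℕ (lookup A i) < toℕ (lookup B j)

  -- `numEdges` counts pairs u < v. As A lies below B, such a pair has u in A and v in B, both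
  -- touched, so each edge is matched with one pair of touched positions and none is counted twice.
  numEdges≤touched : ∀ σ A B → Ordered (A , B) → IsSimple σ → σ ⊆ edgeSet (A , B) →
    numEdges σ ≤ ∣ touched σ A ∣ * ∣ touched σ B ∣
  numEdges≤touched σ A B ord simp σ⊆x = begin
    numEdges σ
      ≤⟨ ∑-mono (allFin n) (λ u → ∑-mono (allFin n) λ v → pointwise u v _ refl) ⟩
    (∑[ u ← allFin n ] ∑[ v ← allFin n ] a A u * a B v)
      ≡⟨ ∑-cong (allFin n) (λ u → ∑-*ˡ (allFin n) (a A u) (a B)) ⟩
    (∑[ u ← allFin n ] a A u * ∑ (allFin n) (a B))
      ≡⟨ ∑-*ʳ (allFin n) _ (a A) ⟩
    ∑ (allFin n) (a A) * ∑ (allFin n) (a B)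
      ≡⟨ cong₂ _*_ (∑-a A) (∑-a B) ⟩
    ∣ touched σ A ∣ * ∣ touched σ B ∣ ∎
    where
    open ≤-Reasoning
    open IsSimple simp
    a : ∀ {k} → Vec (Fin n) k → Fin n → ℕ
    a {k} A u = ∑[ i ← allFin k ] (if lookup (touched σ A) i then 1 else 0) * 𝟙 (lookup A i ≟ᶠ u)
    ∑-a : ∀ {k} (A : Vec (Fin n) k) → ∑ (allFin n) (a A) ≡ ∣ touched σ A ∣
    ∑-a {k} A = trans (∑-comm (allFin n) (allFin k) _) (trans (∑-cong (allFin k) λ i →
        trans (∑-*ˡ (allFin n) (if lookup (touched σ A) i then 1 else 0) _)
          (trans (cong ((if lookup (touched σ A) i then 1 else 0) *_) (allFin-once (lookup A i))) (*-identityʳ _)))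
      (sym (∣∣-∑ (touched σ A))))
    a-pos : ∀ {k} (A : Vec (Fin n) k) i v → adj σ (lookup A i) v ≡ true → 1 ≤ a A (lookup A i)
    a-pos A i v eq = ≤-trans
      (≤-reflexive (sym (cong₂ _*_ (cong (λ b → if b then 1 else 0) (touched⁺ σ A eq)) (𝟙-yes (lookup A i ≟ᶠ lookup A i) refl))))
      (∑-∈ (λ j → (if lookup (touched σ A) j then 1 else 0) * 𝟙 (lookup A j ≟ᶠ lookup A i)) (∈-allFin i))
    pointwise : ∀ u v b → (toℕ u <ᵇ toℕ v) ∧ adj σ u v ≡ b → (if b then 1 else 0) ≤ a A u * a B v
    pointwise u v false _ = z≤n
    pointwise u v true eq with ∧-true _ _ eq
    ... | u<v , σuv with adj-edgeSet⁻ (A , B) u v (σ⊆x u v σuv)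
    ...   | i , j , inj₁ (refl , refl) = *-mono-≤ (a-pos A i v σuv) (a-pos B j u (trans (symmetric v u) σuv))
    ...   | i , j , inj₂ (refl , refl) = ⊥-elim (<-asym (ord i j) (<ᵇ⇒< _ _ (subst T (sym u<v) _)))

  module Greedy (q : ℕ) (1≤q : 1 ≤ q) where

    -- The test ranges over pairs of position sets and not over σ. Among all σ touching exactly the
    -- positions `I` and `J`, the complete bipartite one has most edges and hence the strictest
    -- threshold, and all of them have the same vertices.
    Saturated : List (Biclique n s t) → Biclique n s t → Set
    Saturated H x = ∃ λ I → ∃ λ J → Nonempty I × Nonempty J × q ^ (s * t ∸ ∣ I ∣ * ∣ J ∣) ≤ codegree I J H x

    saturated? : ∀ H x → Dec (Saturated H x)
    saturated? H x = anySubset? λ I → anySubset? λ J → nonempty? I ×-dec nonempty? J ×-dec (_ ≤? _)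

    greedy : List (Biclique n s t) → List (Biclique n s t)
    greedy []       = []
    greedy (x ∷ xs) with saturated? (greedy xs) x
    ... | yes _ = greedy xs
    ... | no  _ = x ∷ greedy xs

    greedy-All : ∀ {P : Biclique n s t → Set} {xs} → All P xs → All P (greedy xs)
    greedy-All [] = []
    greedy-All {xs = x ∷ xs} (p ∷ ps) with saturated? (greedy xs) x
    ... | yes _ = greedy-All ps
    ... | no  _ = p ∷ greedy-All ps

    greedy-degree : ∀ {xs} → All Ordered xs → ∀ {σ} → IsSimple σ → 1 ≤ numEdges σ →
      degree (map edgeSet (greedy xs)) σ ≤ q ^ (s * t ∸ numEdges σ)
    greedy-degree []  _ _ = z≤n
    greedy-degree {x@(A , B) ∷ xs} (o ∷ os) {σ} simp 1≤σ with saturated? (greedy xs) x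
    ... | yes _ = greedy-degree os simp 1≤σ
    ... | no unsat = subst (_≤ _) (sym (degree-∷ (edgeSet x) (map edgeSet (greedy xs)) σ)) (bound ((σ ⊆ᵇ edgeSet x) ≟ᵇ true))
      where
      open ≤-Reasoning
      I = touched σ A
      J = touched σ B
      bound : ∀ d → 𝟙 d + degree (map edgeSet (greedy xs)) σ ≤ q ^ (s * t ∸ numEdges σ)
      bound (no _)    = greedy-degree os simp 1≤σ
      bound (yes σ⊆x) = begin
        suc (degree (map edgeSet (greedy xs)) σ) ≤⟨ s≤s (degree≤codegree σ (greedy xs) A B) ⟩
        suc (codegree I J (greedy xs) x)
          -- The failed test is a strict inequality, which leaves room for the copy that is being
          -- added.
          ≤⟨ ≰⇒> (λ sat → unsat (I , J , ∣∣>0⇒Nonempty I (proj₁ (pos ∣ I ∣ ∣ J ∣ 1≤IJ)) , ∣∣>0⇒Nonempty J (proj₂ (pos ∣ I ∣ ∣ J ∣ 1≤IJ)) , sat)) ⟩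
        q ^ (s * t ∸ ∣ I ∣ * ∣ J ∣) ≤⟨ ^-monoʳ-≤ q {{>-nonZero 1≤q}} (∸-monoʳ-≤ (s * t) σ≤IJ) ⟩
        q ^ (s * t ∸ numEdges σ) ∎
        where
        σ≤IJ : numEdges σ ≤ ∣ I ∣ * ∣ J ∣
        σ≤IJ = numEdges≤touched σ A B o simp (⊆ᵇ⇒⊆ σ (edgeSet x) σ⊆x)
        1≤IJ : 1 ≤ ∣ I ∣ * ∣ J ∣
        1≤IJ = ≤-trans 1≤σ σ≤IJ
        pos : ∀ a b → 1 ≤ a * b → 0 < a × 0 < b
        pos (suc a) (suc b) _ = s≤s z≤n , s≤s z≤n
        pos (suc a) zero    h with () ← subst (1 ≤_) (*-zeroʳ a) h

    module _ (i₀ : Fin s) (j₀ : Fin t) where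

      sharing-self : ∀ h x → edgeSet x ≡ edgeSet h → 1 ≤ sharing ⊤ ⊤ h x
      sharing-self h x@(A , B) eq = *-mono-≤
        (weight-pos ⊤ A λ {i} _ → edge-vertex h _ _ (trans (cong (λ e → adj e (lookup A i) (lookup B j₀)) (sym eq)) (adj-edgeSet⁺ x _ _ (i , j₀ , inj₁ (refl , refl)))))
        (weight-pos ⊤ B λ {j} _ → edge-vertex h _ _ (trans (cong (λ e → adj e (lookup B j) (lookup A i₀)) (sym eq)) (adj-edgeSet⁺ x _ _ (i₀ , j , inj₂ (refl , refl)))))

      -- For the full position sets the threshold is q^0 = 1, so one member with the same edge set
      -- already saturates `x`. This rules out duplicates, and it makes every accepted copy
      -- saturated as well.
      saturated-self : ∀ H x h → h ∈ H → edgeSet x ≡ edgeSet h → Saturated H x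
      saturated-self H x h h∈H eq = ⊤ , ⊤ , (i₀ , ∈⊤) , (j₀ , ∈⊤) , (begin
        q ^ (s * t ∸ ∣ ⊤ {s} ∣ * ∣ ⊤ {t} ∣) ≡⟨ cong (q ^_) (trans (cong₂ (λ a b → s * t ∸ a * b) (∣⊤∣≡n s) (∣⊤∣≡n t)) (n∸n≡0 (s * t))) ⟩
        1 ≤⟨ sharing-self h x eq ⟩
        sharing ⊤ ⊤ h x ≤⟨ ∑-∈ (λ h → sharing ⊤ ⊤ h x) h∈H ⟩
        codegree ⊤ ⊤ H x ∎)
        where open ≤-Reasoning

      greedy-Unique : ∀ xs → Unique (map edgeSet (greedy xs))
      greedy-Unique [] = []
      greedy-Unique (x ∷ xs) with saturated? (greedy xs) x
      ... | yes _    = greedy-Unique xs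
      ... | no unsat = All-map⁺ (All.tabulate λ h∈H eq → unsat (saturated-self (greedy xs) x _ h∈H eq)) ∷ greedy-Unique xs

      saturated-∷ : ∀ x H y → Saturated H y → Saturated (x ∷ H) y
      saturated-∷ x H y (I , J , I≢∅ , J≢∅ , h) = I , J , I≢∅ , J≢∅ , ≤-trans h (m≤n+m _ (sharing I J x y))

      -- Saturation persists as the family grows, and accepted copies saturate themselves, so the
      -- double counting can run over the whole list.
      greedy-saturated : ∀ {xs y} → y ∈ xs → Saturated (greedy xs) y
      greedy-saturated {x ∷ xs} y∈ with saturated? (greedy xs) x | y∈
      ... | yes sat | here refl  = sat
      ... | yes _   | there y∈xs = greedy-saturated y∈xs
      ... | no _    | here refl  = saturated-self (x ∷ greedy xs) x x (here refl) refl
      ... | no _    | there y∈xs = saturated-∷ x (greedy xs) _ (greedy-saturated y∈xs)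

-- Double counting of saturated copies

module _ {n s t : ℕ} (q : ℕ) (1≤q : 1 ≤ q) where

  open Greedy {n} {s} {t} q 1≤q

  private
    nonempties : ∀ k → List (Subset k)
    nonempties k = filter nonempty? (subsets k)

    length-nonempties : ∀ k → length (nonempties k) ≤ 2 ^ k
    length-nonempties k = ≤-trans (length-filter nonempty? (subsets k)) (≤-reflexive (length-vecs _ k))

  -- The factor `q ^ (∣ I ∣ * ∣ J ∣)` brings all thresholds to the common value `q ^ (s * t)`, so a
  -- sum over all pairs can stand in for the unknown saturated pair.
  saturated⇒∑ : ∀ H x → Saturated H x →
    q ^ (s * t) ≤ ∑[ I ← nonempties s ] ∑[ J ← nonempties t ] q ^ (∣ I ∣ * ∣ J ∣) * codegree I J H x
  saturated⇒∑ H x (I , J , I≢∅ , J≢∅ , sat) = begin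
    q ^ (s * t) ≡⟨ cong (q ^_) (m+[n∸m]≡n (*-mono-≤ (∣p∣≤n I) (∣p∣≤n J))) ⟨
    q ^ (∣ I ∣ * ∣ J ∣ + (s * t ∸ ∣ I ∣ * ∣ J ∣)) ≡⟨ ^-distribˡ-+-* q (∣ I ∣ * ∣ J ∣) _ ⟩
    q ^ (∣ I ∣ * ∣ J ∣) * q ^ (s * t ∸ ∣ I ∣ * ∣ J ∣) ≤⟨ *-monoʳ-≤ (q ^ (∣ I ∣ * ∣ J ∣)) sat ⟩
    q ^ (∣ I ∣ * ∣ J ∣) * codegree I J H x
      ≤⟨ ∑-∈ (λ J → q ^ (∣ I ∣ * ∣ J ∣) * codegree I J H x) (∈-filter⁺ nonempty? (∈-subsets J) J≢∅) ⟩
    (∑[ J ← nonempties t ] q ^ (∣ I ∣ * ∣ J ∣) * codegree I J H x)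
      ≤⟨ ∑-∈ (λ I → ∑[ J ← nonempties t ] q ^ (∣ I ∣ * ∣ J ∣) * codegree I J H x) (∈-filter⁺ nonempty? (∈-subsets I) I≢∅) ⟩
    (∑[ I ← nonempties s ] ∑[ J ← nonempties t ] q ^ (∣ I ∣ * ∣ J ∣) * codegree I J H x) ∎
    where open ≤-Reasoning

  -- After exchanging sums, each of the at most 2^s · 2^t pairs and each `h` in the subfamily
  -- contributes at most X / Y. The denominator `Y` is kept on the left; it will be `r * m`.
  greedy-count : Fin s → Fin t → ∀ xs {X Y} →
    (∀ I J h → Nonempty I → Nonempty J → q ^ (∣ I ∣ * ∣ J ∣) * ∑ xs (sharing I J h) * Y ≤ X) →
    length xs * q ^ (s * t) * Y ≤ 2 ^ s * (2 ^ t * (length (greedy xs) * X))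
  greedy-count i₀ j₀ xs {X} {Y} bound = begin
    length xs * q ^ (s * t) * Y
      ≡⟨ cong (_* Y) (∑-const xs _) ⟨
    ∑ xs (λ _ → q ^ (s * t)) * Y
      ≤⟨ *-monoˡ-≤ Y (∑-mono-∈ xs λ {x} x∈ → saturated⇒∑ H x (greedy-saturated i₀ j₀ x∈)) ⟩
    (∑[ x ← xs ] ∑[ I ← Is ] ∑[ J ← Js ] Q I J * codegree I J H x) * Y
      ≡⟨ cong (_* Y) (trans (∑-comm xs Is _) (∑-cong Is λ I → ∑-comm xs Js _)) ⟩
    (∑[ I ← Is ] ∑[ J ← Js ] ∑[ x ← xs ] Q I J * codegree I J H x) * Y
      ≡⟨ trans (∑-cong Is λ I → ∑-*ʳ Js Y _) (∑-*ʳ Is Y _) ⟨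
    (∑[ I ← Is ] ∑[ J ← Js ] (∑[ x ← xs ] Q I J * codegree I J H x) * Y)
      ≡⟨ ∑-cong Is (λ I → ∑-cong Js λ J → cong (_* Y) (trans (∑-*ˡ xs (Q I J) _) (cong (Q I J *_) (∑-comm xs H _)))) ⟩
    (∑[ I ← Is ] ∑[ J ← Js ] Q I J * (∑[ h ← H ] ∑ xs (sharing I J h)) * Y)
      ≡⟨ ∑-cong Is (λ I → ∑-cong Js λ J → trans (∑-*ʳ H Y _) (cong (_* Y) (∑-*ˡ H (Q I J) _))) ⟨
    (∑[ I ← Is ] ∑[ J ← Js ] ∑[ h ← H ] Q I J * ∑ xs (sharing I J h) * Y)
      ≤⟨ ∑-≤-const Is (λ {I} I∈ → ≤-trans
           (∑-≤-const Js λ {J} J∈ → ∑-≤-const H λ {h} _ → bound I J h (nonempty I∈) (nonempty J∈))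
           (*-monoˡ-≤ (length H * X) (length-nonempties t))) ⟩
    length Is * (2 ^ t * (length H * X))
      ≤⟨ *-monoˡ-≤ (2 ^ t * (length H * X)) (length-nonempties s) ⟩
    2 ^ s * (2 ^ t * (length H * X)) ∎
    where
    open ≤-Reasoning
    H = greedy xs
    Is = nonempties s
    Js = nonempties t
    Q : Subset s → Subset t → ℕ
    Q I J = q ^ (∣ I ∣ * ∣ J ∣)
    nonempty : ∀ {k} {I : Subset k} → I ∈ nonempties k → Nonempty I
    nonempty {k} I∈ = proj₂ (∈-filter⁻ nonempty? {xs = subsets k} I∈)

-- Building copies of K_{s,t}

module Construction {n s t : ℕ} (G : Graph n) (i₀ : Fin s) (j₀ : Fin t) where

  open Multiplicity (_≟ᶠ_ {n})

  private
    _≟ᵗ_ : DecidableEquality (Vec (Fin n) s)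
    _≟ᵗ_ = ≡-dec _≟ᶠ_

    isEdge : Fin n → Fin n → Bool
    isEdge u v = (toℕ u <ᵇ toℕ v) ∧ adj (Graph.mat G) u v

    edge : Fin n → Fin n → Bool → List (Fin n × Fin n)
    edge u v b = if b then [ (v , u) ] else []

  -- Edges are oriented downwards, so that the side A of every biclique lies below the side B.
  edges : List (Fin n × Fin n)
  edges = concatMap (λ u → concatMap (λ v → edge u v (isEdge u v)) (allFin n)) (allFin n)

  ∑-edges : ∀ φ → ∑ edges φ ≡ ∑[ u ← allFin n ] ∑[ v ← allFin n ] (if isEdge u v then φ (v , u) else 0)
  ∑-edges φ = trans (∑-concatMap _ (allFin n) φ) (∑-cong (allFin n) λ u →
    trans (∑-concatMap _ (allFin n) φ) (∑-cong (allFin n) λ v → single u v (isEdge u v)))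
    where
    single : ∀ u v b → ∑ (edge u v b) φ ≡ (if b then φ (v , u) else 0)
    single u v true  = +-identityʳ _
    single u v false = refl

  length-edges : length edges ≡ e G
  length-edges = trans (length-∑ edges) (∑-edges (λ _ → 1))

  edges-simple : ∀ k w → (∑[ x ← edges ] 𝟙 (proj₁ x ≟ᶠ k) * 𝟙 (proj₂ x ≟ᶠ w)) ≤ 1
  edges-simple k w = begin
    (∑[ x ← edges ] 𝟙 (proj₁ x ≟ᶠ k) * 𝟙 (proj₂ x ≟ᶠ w))
      ≡⟨ ∑-edges _ ⟩
    (∑[ u ← allFin n ] ∑[ v ← allFin n ] (if isEdge u v then 𝟙 (v ≟ᶠ k) * 𝟙 (u ≟ᶠ w) else 0))
      ≤⟨ ∑-mono (allFin n) (λ u → ∑-mono (allFin n) λ v → if≤ (isEdge u v)) ⟩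
    (∑[ u ← allFin n ] ∑[ v ← allFin n ] 𝟙 (v ≟ᶠ k) * 𝟙 (u ≟ᶠ w))
      ≡⟨ ∑-cong (allFin n) (λ u → trans (∑-*ʳ (allFin n) (𝟙 (u ≟ᶠ w)) _) (trans (cong (_* 𝟙 (u ≟ᶠ w)) (once k)) (*-identityˡ _))) ⟩
    (∑[ u ← allFin n ] 𝟙 (u ≟ᶠ w))
      ≡⟨ once w ⟩
    1 ∎
    where
    open ≤-Reasoning
    if≤ : ∀ b {x} → (if b then x else 0) ≤ x
    if≤ true  = ≤-refl
    if≤ false = z≤n
    once : ∀ k → (∑[ v ← allFin n ] 𝟙 (v ≟ᶠ k)) ≡ 1
    once k = trans (∑-cong (allFin n) λ v → 𝟙-⇔ (v ≟ᶠ k) (k ≟ᶠ v) sym sym) (allFin-once k)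

  ∈-edges⁻ : ∀ {u v} → (v , u) ∈ edges → toℕ u < toℕ v × adj (Graph.mat G) u v ≡ true
  ∈-edges⁻ x∈ with find (∈-concatMap⁻ _ {xs = allFin n} x∈)
  ... | u , _ , x∈u with find (∈-concatMap⁻ (λ v → edge u v (isEdge u v)) {xs = allFin n} x∈u)
  ...   | v , _ , x∈uv = single (isEdge u v) refl x∈uv
    where
    single : ∀ b → isEdge u v ≡ b → ∀ {u′ v′} → (v′ , u′) ∈ edge u v b →
      toℕ u′ < toℕ v′ × adj (Graph.mat G) u′ v′ ≡ true
    single true eq (here refl) with ∧-true _ _ eq
    ... | u<v , uv = <ᵇ⇒< _ _ (subst T (sym u<v) _) , uv

  ∑-edges-mult : ∀ V → (∑[ x ← edges ] mult V (proj₁ x) * mult V (proj₂ x)) ≤ length V * length V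
  ∑-edges-mult V = begin
    (∑[ x ← edges ] mult V (proj₁ x) * mult V (proj₂ x))
      ≡⟨ ∑-cong edges (λ x → trans (sym (∑-*ʳ V _ _)) (∑-cong V λ v → sym (∑-*ˡ V (𝟙 (proj₁ x ≟ᶠ v)) _))) ⟩
    (∑[ x ← edges ] ∑[ v ← V ] ∑[ w ← V ] 𝟙 (proj₁ x ≟ᶠ v) * 𝟙 (proj₂ x ≟ᶠ w))
      ≡⟨ trans (∑-comm edges V _) (∑-cong V λ v → ∑-comm edges V _) ⟩
    (∑[ v ← V ] ∑[ w ← V ] ∑[ x ← edges ] 𝟙 (proj₁ x ≟ᶠ v) * 𝟙 (proj₂ x ≟ᶠ w))
      ≤⟨ ∑-≤-const V (λ {v} _ → ≤-trans (∑-≤-const V λ {w} _ → edges-simple v w) (≤-reflexive (*-identityʳ _))) ⟩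
    length V * length V ∎
    where open ≤-Reasoning

  module Stars {m : ℕ} (0<m : 0 < m) where

    private module E = Expansion (_≟ᶠ_ {n}) _≟ᶠ_ (allFin n) allFin-once i₀ 0<m edges

    open E public using () renaming (numBlocks to numBlocks₁)

    stars : List (Vec (Fin n) s × Fin n)
    stars = map swap E.expand

    length-stars : length stars ≡ numBlocks₁ * m ^ s
    length-stars = trans (length-map swap E.expand) E.length-expand

    numBlocks₁-≤ : numBlocks₁ * (s * m) ≤ e G
    numBlocks₁-≤ = subst (numBlocks₁ * (s * m) ≤_) length-edges E.numBlocks-≤-length

    ≤-numBlocks₁ : e G ≤ numBlocks₁ * (s * m) + n * (s * m)
    ≤-numBlocks₁ = subst₂ (λ x y → x ≤ numBlocks₁ * (s * m) + y * (s * m)) length-edges (length-tabulate {n = n} id) E.length-≤-numBlocks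

    stars-simple : ∀ A b → (∑[ x ← stars ] 𝟙 (proj₁ x ≟ᵗ A) * 𝟙 (proj₂ x ≟ᶠ b)) ≤ 1
    stars-simple A b = subst (_≤ 1) (sym (trans (∑-map swap E.expand _) (∑-cong E.expand λ y → *-comm (𝟙 (proj₂ y ≟ᵗ A)) _)))
      (E.expand-simple edges-simple b A)

    module Bicliques {r : ℕ} (0<r : 0 < r) where

      private module F = Expansion _≟ᵗ_ (_≟ᶠ_ {n}) (vecs (allFin n) s) (vecs-once _≟ᶠ_ (allFin n) allFin-once) j₀ 0<r stars

      open F public using () renaming (numBlocks to numBlocks₂)

      bicliques : List (Biclique n s t)
      bicliques = F.expand

      length-bicliques : length bicliques ≡ numBlocks₂ * r ^ t
      length-bicliques = F.length-expand

      ≤-numBlocks₂ : numBlocks₁ * m ^ s ≤ numBlocks₂ * (t * r) + n ^ s * (t * r)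
      ≤-numBlocks₂ = subst₂ (λ x y → x ≤ numBlocks₂ * (t * r) + y * (t * r)) length-stars
        (trans (length-vecs (allFin n) s) (cong (_^ s) (length-tabulate {n = n} id))) F.length-≤-numBlocks

      private
        star∈ : ∀ {A B} → (A , B) ∈ bicliques → ∀ j → (lookup B j , A) ∈ E.expand
        star∈ x∈ j with ∈-map⁻ swap (F.expand-entry x∈ j)
        ... | _ , y∈ , refl = y∈

      biclique-Ordered : ∀ {x} → x ∈ bicliques → Ordered x
      biclique-Ordered x∈ i j = proj₁ (∈-edges⁻ (E.expand-entry (star∈ x∈ j) i))

      biclique-copy : ∀ {x} → x ∈ bicliques → IsKstCopy s t G (edgeSet x)
      biclique-copy {x@(A , B)} x∈ = lookup A , lookup B ,
        E.expand-injective edges-simple (star∈ x∈ j₀) ,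
        F.expand-injective stars-simple x∈ ,
        (λ i j eq → <-irrefl (cong toℕ eq) (biclique-Ordered x∈ i j)) ,
        (λ i j → proj₂ (∈-edges⁻ (E.expand-entry (star∈ x∈ j) i))) ,
        λ u v → mk⇔ (adj-edgeSet⁻ x u v) (adj-edgeSet⁺ x u v)

      -- The stages are undone in reverse order. The weight on A is a key weight for the second
      -- expansion; the multiplicity of the retained centre is then a key weight for the first. What
      -- remains is a single edge with both ends among the `c` vertices of `h`, which gives `c * c`.
      ∑-sharing : ∀ I J (h : Biclique n s t) → Nonempty I → Nonempty J →
        let c = s + t in
        ∑ bicliques (sharing I J h) * r ^ ∣ J ∣ * m ^ ∣ I ∣ ≤ (c * r) ^ t * ((c * m) ^ s * (c * c))
      ∑-sharing I J h (i , i∈I) (j , j∈J) = begin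
        ∑ bicliques (sharing I J h) * r ^ ∣ J ∣ * m ^ ∣ I ∣
          ≤⟨ *-monoˡ-≤ (m ^ ∣ I ∣) (F.expand-weight stars-simple 1≤c J {λ _ → V} (λ _ → V≤c) j∈J (weight I (λ _ → V))) ⟩
        (c * r) ^ t * (∑[ x ← stars ] weight I (λ _ → V) (proj₁ x) * mult V (proj₂ x)) * m ^ ∣ I ∣
          ≡⟨ cong (λ z → (c * r) ^ t * z * m ^ ∣ I ∣) (trans (∑-map swap E.expand _) (∑-cong E.expand λ y → *-comm (weight I (λ _ → V) (proj₂ y)) _)) ⟩
        (c * r) ^ t * (∑[ y ← E.expand ] mult V (proj₁ y) * weight I (λ _ → V) (proj₂ y)) * m ^ ∣ I ∣
          ≡⟨ *-assoc ((c * r) ^ t) _ _ ⟩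
        (c * r) ^ t * ((∑[ y ← E.expand ] mult V (proj₁ y) * weight I (λ _ → V) (proj₂ y)) * m ^ ∣ I ∣)
          ≤⟨ *-monoʳ-≤ ((c * r) ^ t) (E.expand-weight edges-simple 1≤c I {λ _ → V} (λ _ → V≤c) i∈I (mult V)) ⟩
        (c * r) ^ t * ((c * m) ^ s * (∑[ x ← edges ] mult V (proj₁ x) * mult V (proj₂ x)))
          ≤⟨ *-monoʳ-≤ ((c * r) ^ t) (*-monoʳ-≤ ((c * m) ^ s) (≤-trans (∑-edges-mult V) (*-mono-≤ V≤c V≤c))) ⟩
        (c * r) ^ t * ((c * m) ^ s * (c * c)) ∎
        where
        open ≤-Reasoning
        c = s + t
        V = vertices h
        V≤c : length V ≤ c
        V≤c = ≤-reflexive (length-vertices h)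
        1≤c : 1 ≤ c
        1≤c = ≤-trans (≤-trans (s≤s z≤n) (toℕ<n i₀)) (m≤m+n s t)

-- Arithmetic

^-distribʳ-* : ∀ a b k → (a * b) ^ k ≡ a ^ k * b ^ k
^-distribʳ-* a b zero    = refl
^-distribʳ-* a b (suc k) = trans (cong (a * b *_) (^-distribʳ-* a b k)) (lemma a b (a ^ k) (b ^ k))
  where
  lemma : ∀ a b c d → a * b * (c * d) ≡ a * c * (b * d)
  lemma = solve-∀

^-cancelʳ-≤ : ∀ k {a b} → 1 ≤ k → a ^ k ≤ b ^ k → a ≤ b
^-cancelʳ-≤ k 1≤k h = ≮⇒≥ λ b<a → <⇒≱ (^-monoˡ-< k {{>-nonZero 1≤k}} b<a) h

^-pos : ∀ {a} k → 1 ≤ a → 1 ≤ a ^ k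
^-pos {a} k 1≤a = m^n>0 a {{>-nonZero 1≤a}} k

greatest : ∀ {P : ℕ → Set} → (∀ k → Dec (P k)) → P 1 → ∀ {N} → ¬ P (suc N) → ∃ λ q → 1 ≤ q × P q × ¬ P (suc q)
greatest P? p1 {zero}  ¬p = ⊥-elim (¬p p1)
greatest P? p1 {suc N} ¬p with P? (suc N)
... | yes p = suc N , s≤s z≤n , p , ¬p
... | no ¬p′ = greatest P? p1 {N} ¬p′

-- An integer part of the p-th root of Z / N without division. It supplies `q` as the integer part
-- of k^(1+ε).
root : ∀ p N Z → 1 ≤ p → 1 ≤ N → N ≤ Z → ∃ λ q → 1 ≤ q × q ^ p * N ≤ Z × Z < suc q ^ p * N
root p N Z 1≤p 1≤N N≤Z with greatest {λ q → q ^ p * N ≤ Z} (λ q → q ^ p * N ≤? Z)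
    (≤-trans (≤-reflexive (trans (cong (_* N) (^-zeroˡ p)) (*-identityˡ N))) N≤Z) {Z} (<⇒≱ (begin
      suc Z          ≡⟨ ^-identityʳ (suc Z) ⟨
      suc Z ^ 1      ≤⟨ ^-monoʳ-≤ (suc Z) 1≤p ⟩
      suc Z ^ p      ≤⟨ m≤m*n (suc Z ^ p) N {{>-nonZero 1≤N}} ⟩
      suc Z ^ p * N  ∎))
  where open ≤-Reasoning
... | q , 1≤q , h , ¬h = q , 1≤q , h , ≰⇒> ¬h

quotient : ∀ x d → 1 ≤ d → d ≤ x → ∃ λ k → 1 ≤ k × d * k ≤ x × x ≤ 2 * (d * k)
quotient x d 1≤d d≤x = k , 1≤k , ≤-trans (≤-reflexive (*-comm d k)) (m/n*n≤m x d) , (begin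
  x                ≡⟨ m≡m%n+[m/n]*n x d ⟩
  x % d + k * d ≤⟨ +-monoˡ-≤ (k * d) (<⇒≤ (m%n<n x d)) ⟩
  d + k * d        ≤⟨ +-monoˡ-≤ (k * d) (m≤n*m d k {{>-nonZero 1≤k}}) ⟩
  k * d + k * d    ≡⟨ lemma k d ⟩
  2 * (d * k)      ∎)
  where
  open ≤-Reasoning
  instance _ = >-nonZero 1≤d
  k = x / d
  1≤k : 1 ≤ k
  1≤k = m≥n⇒m/n>0 d≤x
  lemma : ∀ k d → k * d + k * d ≡ 2 * (d * k)
  lemma = solve-∀

≤-half : ∀ {x} y z → x ≤ y + z → 2 * z ≤ x → x ≤ 2 * y
≤-half {x} y z x≤y+z 2z≤x = +-cancelʳ-≤ x x (2 * y) (begin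
  x + x              ≤⟨ +-mono-≤ x≤y+z x≤y+z ⟩
  y + z + (y + z)    ≡⟨ lemma y z ⟩
  2 * y + 2 * z      ≤⟨ +-monoʳ-≤ (2 * y) 2z≤x ⟩
  2 * y + x          ∎)
  where
  open ≤-Reasoning
  lemma : ∀ y z → y + z + (y + z) ≡ 2 * y + 2 * z
  lemma = solve-∀

n^[2s-1] : ∀ n {s} → 1 ≤ s → n ^ (2 * s ∸ 1) ≡ n ^ s * n ^ (s ∸ 1)
n^[2s-1] n {suc S} _ = trans (cong (n ^_) (lemma S)) (^-distribˡ-+-* n (suc S) S)
  where
  lemma : ∀ S → S + suc (S + 0) ≡ suc S + S
  lemma = solve-∀

edges-lower : ∀ {s t n E} → 1 ≤ s → 1 ≤ t → 1 ≤ n → (4 * s * (2 * t)) ^ s * n ^ (2 * s ∸ 1) ≤ E ^ s →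
  2 * s * n ≤ E
edges-lower {s@(suc S)} {t} {n} {E} _ 1≤t 1≤n h = ^-cancelʳ-≤ (suc S) (s≤s z≤n) (begin
  (2 * s * n) ^ s             ≤⟨ ^-monoˡ-≤ s (*-monoˡ-≤ n (≤-trans (*-monoˡ-≤ s {2} {4} (s≤s (s≤s z≤n))) (m≤m*n (4 * s) (2 * t) {{>-nonZero (*-mono-≤ {1} {2} (s≤s z≤n) 1≤t)}}))) ⟩
  (4 * s * (2 * t) * n) ^ s   ≡⟨ ^-distribʳ-* (4 * s * (2 * t)) n s ⟩
  (4 * s * (2 * t)) ^ s * n ^ s ≤⟨ *-monoʳ-≤ ((4 * s * (2 * t)) ^ s) (≤-trans (m≤m*n (n ^ s) (n ^ S) {{>-nonZero (^-pos S 1≤n)}}) (≤-reflexive (sym (n^[2s-1] n {s} (s≤s z≤n))))) ⟩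
  (4 * s * (2 * t)) ^ s * n ^ (2 * s ∸ 1) ≤⟨ h ⟩
  E ^ s ∎)
  where
  open ≤-Reasoning

-- One factor `E` is replaced through the block count `M`, the other s - 1 through the size of `m`.
-- In terms of k, the number `M * m ^ s` of small stars is at least (k n / 4s)^s.
edges^s-upper : ∀ {s n E M m} → 1 ≤ s → E ≤ 2 * (M * (s * m)) → E ≤ 2 * (2 * s * n * m) →
  E ^ s ≤ (4 * s) ^ s * n ^ (s ∸ 1) * (M * m ^ s)
edges^s-upper {s@(suc S)} {n} {E} {M} {m} _ h₁ h₂ = begin
  E * E ^ S
    ≤⟨ *-mono-≤ h₁ (^-monoˡ-≤ S h₂) ⟩
  2 * (M * (s * m)) * (2 * (2 * s * n * m)) ^ S
    ≡⟨ cong (λ z → 2 * (M * (s * m)) * z ^ S) (lemma₁ s n m) ⟩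
  2 * (M * (s * m)) * (4 * s * n * m) ^ S
    ≡⟨ cong (2 * (M * (s * m)) *_) (trans (^-distribʳ-* (4 * s * n) m S) (cong (_* m ^ S) (^-distribʳ-* (4 * s) n S))) ⟩
  2 * (M * (s * m)) * ((4 * s) ^ S * n ^ S * m ^ S)
    ≤⟨ *-monoˡ-≤ ((4 * s) ^ S * n ^ S * m ^ S) (*-monoˡ-≤ (M * (s * m)) {2} {4} (s≤s (s≤s z≤n))) ⟩
  4 * (M * (s * m)) * ((4 * s) ^ S * n ^ S * m ^ S)
    ≡⟨ lemma₂ s M m ((4 * s) ^ S) (n ^ S) (m ^ S) ⟩
  (4 * s) ^ s * n ^ S * (M * m ^ s) ∎
  where
  open ≤-Reasoning
  lemma₁ : ∀ s n m → 2 * (2 * s * n * m) ≡ 4 * s * n * m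
  lemma₁ = solve-∀
  lemma₂ : ∀ s M m a b c → 4 * (M * (s * m)) * (a * b * c) ≡ 4 * s * a * b * (M * (m * c))
  lemma₂ = solve-∀

stars-lower : ∀ {s t n E X} → 1 ≤ s → 1 ≤ t → 1 ≤ n → (4 * s * (2 * t)) ^ s * n ^ (2 * s ∸ 1) ≤ E ^ s →
  E ^ s ≤ (4 * s) ^ s * n ^ (s ∸ 1) * X → 2 * t * n ^ s ≤ X
stars-lower {s@(suc S)} {t} {n} {E} {X} _ 1≤t 1≤n h₁ h₂ =
  *-cancelˡ-≤ ((4 * s) ^ s * n ^ S) {{>-nonZero (*-mono-≤ (^-pos {4 * s} s (s≤s z≤n)) (^-pos S 1≤n))}} (begin
  (4 * s) ^ s * n ^ S * (2 * t * n ^ s)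
    ≤⟨ *-monoʳ-≤ ((4 * s) ^ s * n ^ S) (*-monoˡ-≤ (n ^ s) (m≤m*n (2 * t) ((2 * t) ^ S) {{>-nonZero (^-pos S (*-mono-≤ {1} {2} (s≤s z≤n) 1≤t))}})) ⟩
  (4 * s) ^ s * n ^ S * ((2 * t) ^ s * n ^ s)
    ≡⟨ lemma ((4 * s) ^ s) (n ^ S) ((2 * t) ^ s) (n ^ s) ⟩
  (4 * s) ^ s * (2 * t) ^ s * (n ^ s * n ^ S)
    ≡⟨ cong₂ _*_ (^-distribʳ-* (4 * s) (2 * t) s) (n^[2s-1] n {s} (s≤s z≤n)) ⟨
  (4 * s * (2 * t)) ^ s * n ^ (2 * s ∸ 1)
    ≤⟨ ≤-trans h₁ h₂ ⟩
  (4 * s) ^ s * n ^ S * X ∎)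
  where
  open ≤-Reasoning
  lemma : ∀ a b c d → a * b * (c * d) ≡ a * c * (d * b)
  lemma = solve-∀

-- The constant in k^s ≤ `density s t` · r. The factor (4s)^s comes from counting stars, and 4t from
-- rounding down in the choice of r.
density : ℕ → ℕ → ℕ
density s t = (4 * s) ^ s * (4 * t)

edges^s≤density : ∀ {s t n E X r} → 1 ≤ s → E ^ s ≤ (4 * s) ^ s * n ^ (s ∸ 1) * X → X ≤ 2 * (2 * t * n ^ s * r) →
  E ^ s ≤ density s t * r * n ^ (2 * s ∸ 1)
edges^s≤density {s@(suc S)} {t} {n} {E} {X} {r} _ h₁ h₂ = begin
  E ^ s ≤⟨ h₁ ⟩
  (4 * s) ^ s * n ^ S * X ≤⟨ *-monoʳ-≤ ((4 * s) ^ s * n ^ S) h₂ ⟩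
  (4 * s) ^ s * n ^ S * (2 * (2 * t * n ^ s * r)) ≡⟨ lemma ((4 * s) ^ s) (n ^ S) (n ^ s) t r ⟩
  density s t * r * (n ^ s * n ^ S) ≡⟨ cong (density s t * r *_) (n^[2s-1] n {s} (s≤s z≤n)) ⟨
  density s t * r * n ^ (2 * s ∸ 1) ∎
  where
  open ≤-Reasoning
  lemma : ∀ a b c t r → a * b * (2 * (2 * t * c * r)) ≡ a * (4 * t) * r * (c * b)
  lemma = solve-∀

-- Of the s factors `m` in the number of stars, one joins `M` to give at most n², one is kept, and
-- the other s - 2 are at most n each. The comparison lets a prescribed vertex on side A, worth `m`,
-- count for at least `r`.
r≤m : ∀ {s t n E M m r} → 2 ≤ s → 1 ≤ t → 1 ≤ n → E ≤ n * n → M * (s * m) ≤ E → 2 * s * n * m ≤ E →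
  2 * t * n ^ s * r ≤ M * m ^ s → r ≤ m
r≤m {s@(suc (suc S))} {t} {n} {E} {M} {m} {r} (s≤s (s≤s _)) 1≤t 1≤n E≤n² h₁ h₂ h₃ = *-cancelˡ-≤ (n ^ s) {{>-nonZero (^-pos s 1≤n)}} (begin
  n ^ s * r ≤⟨ *-monoˡ-≤ r (m≤n*m (n ^ s) (2 * t) {{>-nonZero (*-mono-≤ {1} {2} (s≤s z≤n) 1≤t)}}) ⟩
  2 * t * n ^ s * r ≤⟨ h₃ ⟩
  M * m ^ s ≡⟨ *-assoc M m _ ⟨
  M * m * (m * m ^ S) ≤⟨ *-mono-≤ (≤-trans (≤-trans (*-monoʳ-≤ M (m≤n*m m s)) h₁) E≤n²) (*-monoʳ-≤ m (^-monoˡ-≤ S m≤n)) ⟩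
  n * n * (m * n ^ S) ≡⟨ lemma n m (n ^ S) ⟩
  n ^ s * m ∎)
  where
  open ≤-Reasoning
  lemma : ∀ n m a → n * n * (m * a) ≡ n * (n * a) * m
  lemma = solve-∀
  m≤n : m ≤ n
  m≤n = *-cancelˡ-≤ n {{>-nonZero 1≤n}} (≤-trans (*-monoˡ-≤ m (m≤n*m n (2 * s))) (≤-trans h₂ E≤n²))

-- The gain ε = 1/(st) over the exponent 1 is paid for by (i+1)(j+1) − 1 < s(i + j) for (i , j) ≠ (0 , 0).
q^[ij-1]≤ : ∀ {s t q D i j} → 2 ≤ s → 1 ≤ D → i < s → suc i * suc j ≤ s * t →
  q ^ (s * (s * t)) ≤ D ^ (s * t + 1) → q ^ (i + j + i * j) ≤ D ^ (i + j)
q^[ij-1]≤ {s@(suc (suc S))} {t} {q} {D} {zero} {zero} (s≤s (s≤s _)) 1≤D i≤ ij≤ h = ≤-refl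
q^[ij-1]≤ {s@(suc (suc S))} {t} {q} {D} {i} {j} (s≤s (s≤s _)) 1≤D i≤ ij≤ h with 1 ≤? i + j
... | no i+j≱1 rewrite n<1⇒n≡0 (≰⇒> i+j≱1) | m+n≡0⇒m≡0 i (n<1⇒n≡0 (≰⇒> i+j≱1)) = ≤-refl
... | yes 1≤i+j = ^-cancelʳ-≤ (s * b) (≤-trans 1≤b (m≤n*m b s)) (begin
  (q ^ P) ^ (s * b) ≡⟨ trans (^-*-assoc q P (s * b)) (trans (cong (q ^_) (*-comm P (s * b))) (sym (^-*-assoc q (s * b) P))) ⟩
  (q ^ (s * b)) ^ P ≤⟨ ^-monoˡ-≤ P h ⟩
  (D ^ (b + 1)) ^ P ≡⟨ ^-*-assoc D (b + 1) P ⟩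
  D ^ ((b + 1) * P) ≤⟨ ^-monoʳ-≤ D {{>-nonZero 1≤D}} exponent ⟩
  D ^ ((i + j) * (s * b)) ≡⟨ ^-*-assoc D (i + j) (s * b) ⟨
  (D ^ (i + j)) ^ (s * b) ∎)
  where
  open ≤-Reasoning
  b = s * t
  P = i + j + i * j
  lemma₀ : ∀ i j → suc i * suc j ≡ suc (i + j + i * j)
  lemma₀ = solve-∀
  P<b : suc P ≤ b
  P<b = ≤-trans (≤-reflexive (sym (lemma₀ i j))) ij≤
  1≤b : 1 ≤ b
  1≤b = ≤-trans (s≤s z≤n) P<b
  gap : suc P ≤ s * (i + j)
  gap = go i j (≤-pred i≤) 1≤i+j
    where
    e₂ : ∀ i j → suc (suc i + j + suc i * j) + i ≡ 2 * suc i + (j + suc i * j)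
    e₂ = solve-∀
    e₃ : ∀ S i j → 2 * suc i + suc (suc S) * j + S * suc i ≡ suc (suc S) * (suc i + j)
    e₃ = solve-∀
    go : ∀ i j → i ≤ suc S → 1 ≤ i + j → suc (i + j + i * j) ≤ s * (i + j)
    go zero (suc j) _ _ = begin
      suc (suc j + 0)   ≡⟨ cong suc (+-identityʳ (suc j)) ⟩
      1 + suc j         ≤⟨ +-monoˡ-≤ (suc j) (s≤s z≤n) ⟩
      suc j + suc j     ≡⟨ cong (suc j +_) (+-identityʳ (suc j)) ⟨
      2 * suc j         ≤⟨ *-monoˡ-≤ (suc j) {2} {s} (s≤s (s≤s z≤n)) ⟩
      s * suc j         ∎
    go (suc i) j i≤ _ = begin
      suc (suc i + j + suc i * j)     ≤⟨ m≤m+n _ i ⟩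
      suc (suc i + j + suc i * j) + i ≡⟨ e₂ i j ⟩
      2 * suc i + suc (suc i) * j     ≤⟨ +-monoʳ-≤ (2 * suc i) (*-monoˡ-≤ j (s≤s i≤)) ⟩
      2 * suc i + s * j               ≤⟨ m≤m+n _ (S * suc i) ⟩
      2 * suc i + s * j + S * suc i   ≡⟨ e₃ S i j ⟩
      s * (suc i + j)                 ∎
  -- Since ε = 1/b and P < b, the surplus over the exponent P is less than 1, and the integer gap of
  -- one in `gap` absorbs it.
  exponent : (b + 1) * P ≤ (i + j) * (s * b)
  exponent = begin
    (b + 1) * P     ≡⟨ l₁ b P ⟩
    b * P + P       ≤⟨ +-monoʳ-≤ (b * P) (<⇒≤ P<b) ⟩
    b * P + b       ≡⟨ l₂ b P ⟩
    b * suc P       ≤⟨ *-monoʳ-≤ b gap ⟩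
    b * (s * (i + j)) ≡⟨ l₃ b s (i + j) ⟩
    (i + j) * (s * b) ∎
    where
    l₁ : ∀ b P → (b + 1) * P ≡ b * P + P
    l₁ = solve-∀
    l₂ : ∀ b P → b * P + b ≡ b * suc P
    l₂ = solve-∀
    l₃ : ∀ b s x → b * (s * x) ≡ x * (s * b)
    l₃ = solve-∀

-- The first vertex on each side, which together give the first edge, accounts for `r * m` on the
-- left and for the single `q` on the right. All further positions are traded at the rate
-- `q^[ij-1]≤`, at a cost of at most `D ^ (s + t)`.
sharing-bound : ∀ {s t q D r m i j N Z} → 2 ≤ s → let s = s in
  1 ≤ D → 1 ≤ r → r ≤ m → 1 ≤ i → 1 ≤ j → i ≤ s → j ≤ t →
  q ^ (s * (s * t)) ≤ (D * r) ^ (s * t + 1) →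
  N * r ^ j * m ^ i ≤ Z → q ^ (i * j) * N * (r * m) ≤ q * (D ^ (s + t) * Z)
sharing-bound {s@(suc (suc S))} {t} {q} {D} {r} {m} {suc i} {suc j} {N} {Z} 2≤s@(s≤s (s≤s _)) 1≤D 1≤r r≤m _ _ i≤s j≤t h N≤Z = begin
  q ^ (suc i * suc j) * N * (r * m)
    ≡⟨ cong (λ k → q ^ k * N * (r * m)) (lemma₀ i j) ⟩
  q * q ^ (i + j + i * j) * N * (r * m)
    ≤⟨ *-monoˡ-≤ (r * m) (*-monoˡ-≤ N (*-monoʳ-≤ q (q^[ij-1]≤ {s} {t} {q} {D * r} {i} {j} 2≤s (*-mono-≤ 1≤D 1≤r) i≤s (*-mono-≤ i≤s j≤t) h))) ⟩
  q * (D * r) ^ (i + j) * N * (r * m)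
    ≡⟨ cong (λ z → q * z * N * (r * m)) (trans (^-distribʳ-* D r (i + j)) (cong (D ^ (i + j) *_) (^-distribˡ-+-* r i j))) ⟩
  q * (D ^ (i + j) * (r ^ i * r ^ j)) * N * (r * m)
    ≤⟨ *-monoˡ-≤ (r * m) (*-monoˡ-≤ N (*-monoʳ-≤ q (*-mono-≤
         (^-monoʳ-≤ D {{>-nonZero 1≤D}} (+-mono-≤ (<⇒≤ i≤s) (<⇒≤ j≤t))) (*-monoˡ-≤ (r ^ j) (^-monoˡ-≤ i r≤m))))) ⟩
  q * (D ^ (s + t) * (m ^ i * r ^ j)) * N * (r * m)
    ≡⟨ lemma₁ q (D ^ (s + t)) (m ^ i) (r ^ j) N r m ⟩
  q * (D ^ (s + t) * (N * r ^ suc j * m ^ suc i))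
    ≤⟨ *-monoʳ-≤ q (*-monoʳ-≤ (D ^ (s + t)) N≤Z) ⟩
  q * (D ^ (s + t) * Z) ∎
  where
  open ≤-Reasoning
  lemma₀ : ∀ i j → suc i * suc j ≡ suc (i + j + i * j)
  lemma₀ = solve-∀
  lemma₁ : ∀ q a b c N r m → q * (a * (b * c)) * N * (r * m) ≡ q * (a * (N * (r * c) * (m * b)))
  lemma₁ = solve-∀

-- Eliminating `M₁` and then `M₂` produces exactly the factor `r * m` of the double count; the
-- powers r^t and m^s, here `a` and `b`, cancel.
edges≤copies : ∀ {s t E M₁ M₂ m r q Q H a b P P′ D c d f} → 1 ≤ q → 1 ≤ a → 1 ≤ b →
  E ≤ 2 * (M₁ * (s * m)) → M₁ * b ≤ 2 * (M₂ * (t * r)) →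
  M₂ * a * (q * Q) * (r * m) ≤ P * (P′ * (H * (q * (D * (c * a * (d * b * f)))))) →
  E * Q ≤ 4 * s * t * (P * P′ * (D * c * d * f)) * H
edges≤copies {s} {t} {E} {M₁} {M₂} {m} {r} {q} {Q} {H} {a} {b} {P} {P′} {D} {c} {d} {f} 1≤q 1≤a 1≤b h₁ h₂ h₃ =
  *-cancelʳ-≤ _ _ (q * a * b) {{>-nonZero (*-mono-≤ (*-mono-≤ 1≤q 1≤a) 1≤b)}} (begin
  E * Q * (q * a * b)                        ≤⟨ *-monoˡ-≤ (q * a * b) (*-monoˡ-≤ Q h₁) ⟩
  2 * (M₁ * (s * m)) * Q * (q * a * b)       ≡⟨ l₁ M₁ s m Q q a b ⟩
  2 * s * Q * q * a * m * (M₁ * b)           ≤⟨ *-monoʳ-≤ (2 * s * Q * q * a * m) h₂ ⟩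
  2 * s * Q * q * a * m * (2 * (M₂ * (t * r))) ≡⟨ l₂ s Q q a m M₂ t r ⟩
  4 * s * t * (M₂ * a * (q * Q) * (r * m))   ≤⟨ *-monoʳ-≤ (4 * s * t) h₃ ⟩
  4 * s * t * (P * (P′ * (H * (q * (D * (c * a * (d * b * f))))))) ≡⟨ l₃ (4 * s * t) P P′ H q D c a d b f ⟩
  4 * s * t * (P * P′ * (D * c * d * f)) * H * (q * a * b) ∎)
  where
  open ≤-Reasoning
  l₁ : ∀ M s m Q q a b → 2 * (M * (s * m)) * Q * (q * a * b) ≡ 2 * s * Q * q * a * m * (M * b)
  l₁ = solve-∀
  l₂ : ∀ s Q q a m M t r → 2 * s * Q * q * a * m * (2 * (M * (t * r))) ≡ 4 * s * t * (M * a * (q * Q) * (r * m))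
  l₂ = solve-∀
  l₃ : ∀ k P P′ H q D c a d b f →
    k * (P * (P′ * (H * (q * (D * (c * a * (d * b * f))))))) ≡ k * (P * P′ * (D * c * d * f)) * H * (q * a * b)
  l₃ = solve-∀

q-upper : ∀ {s t q n E D r} → 2 ≤ s → 1 ≤ n →
  E ^ s ≤ D * r * n ^ (2 * s ∸ 1) →
  q ^ (s * (s * t)) * n ^ ((2 * s ∸ 1) * (s * t + 1)) ≤ E ^ (s * (s * t + 1)) →
  q ^ (s * (s * t)) ≤ (D * r) ^ (s * t + 1)
q-upper {s@(suc (suc S))} {t} {q} {n} {E} {D} {r} (s≤s (s≤s _)) 1≤n h₁ h₂ =
  *-cancelʳ-≤ _ _ (n ^ (d * b)) {{>-nonZero (^-pos (d * b) 1≤n)}} (begin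
  q ^ (s * (s * t)) * n ^ (d * b)  ≤⟨ h₂ ⟩
  E ^ (s * b)                      ≡⟨ ^-*-assoc E s b ⟨
  (E ^ s) ^ b                      ≤⟨ ^-monoˡ-≤ b h₁ ⟩
  (D * r * n ^ d) ^ b              ≡⟨ ^-distribʳ-* (D * r) (n ^ d) b ⟩
  (D * r) ^ b * (n ^ d) ^ b        ≡⟨ cong ((D * r) ^ b *_) (^-*-assoc n d b) ⟩
  (D * r) ^ b * n ^ (d * b)        ∎)
  where
  open ≤-Reasoning
  d = 2 * s ∸ 1
  b = s * t + 1

-- Here Z / N is the p-th power of k^(1+ε), so `hZ` says that k^(1+ε) ≤ 2q. The core is `base`,
-- before raising to the power p: the exponents w - ℓ and ℓ - 1 of q add up to w - 1.
degree-bound : ∀ {p q w N Z E C H δ ℓ} → 1 ≤ q → Z ≤ (2 * q) ^ p * N → 1 ≤ ℓ → ℓ ≤ w →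
  δ ≤ q ^ (w ∸ ℓ) → E * q ^ (w ∸ 1) ≤ C * H →
  δ ^ p * Z ^ (ℓ ∸ 1) * E ^ p ≤ (2 ^ w * C * H) ^ p * N ^ (ℓ ∸ 1)
degree-bound {p} {q} {w} {N} {Z} {E} {C} {H} {δ} {ℓ} 1≤q hZ 1≤ℓ ℓ≤w hδ hH = begin
  δ ^ p * Z ^ k * E ^ p
    ≤⟨ *-monoˡ-≤ (E ^ p) (*-monoʳ-≤ (δ ^ p) (^-monoˡ-≤ k hZ)) ⟩
  δ ^ p * ((2 * q) ^ p * N) ^ k * E ^ p
    ≡⟨ cong (λ z → δ ^ p * z * E ^ p) (trans (^-distribʳ-* ((2 * q) ^ p) N k) (cong (_* N ^ k) swap-exp)) ⟩
  δ ^ p * (((2 * q) ^ k) ^ p * N ^ k) * E ^ p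
    ≡⟨ l₁ (δ ^ p) (((2 * q) ^ k) ^ p) (N ^ k) (E ^ p) ⟩
  δ ^ p * ((2 * q) ^ k) ^ p * E ^ p * N ^ k
    ≡⟨ cong (_* N ^ k) (trans (^-distribʳ-* (δ * (2 * q) ^ k) E p) (cong (_* E ^ p) (^-distribʳ-* δ ((2 * q) ^ k) p))) ⟨
  (δ * (2 * q) ^ k * E) ^ p * N ^ k
    ≤⟨ *-monoˡ-≤ (N ^ k) (^-monoˡ-≤ p base) ⟩
  (2 ^ w * C * H) ^ p * N ^ k ∎
  where
  open ≤-Reasoning
  k = ℓ ∸ 1
  swap-exp : ((2 * q) ^ p) ^ k ≡ ((2 * q) ^ k) ^ p
  swap-exp = trans (^-*-assoc (2 * q) p k) (trans (cong ((2 * q) ^_) (*-comm p k)) (sym (^-*-assoc (2 * q) k p)))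
  l₁ : ∀ a b c d → a * (b * c) * d ≡ a * b * d * c
  l₁ = solve-∀
  l₂ : ∀ a b c d → a * (b * c) * d ≡ b * (d * (a * c))
  l₂ = solve-∀
  base : δ * (2 * q) ^ k * E ≤ 2 ^ w * C * H
  base = begin
    δ * (2 * q) ^ k * E         ≡⟨ cong (λ z → δ * z * E) (^-distribʳ-* 2 q k) ⟩
    δ * (2 ^ k * q ^ k) * E     ≡⟨ l₂ δ (2 ^ k) (q ^ k) E ⟩
    2 ^ k * (E * (δ * q ^ k))   ≤⟨ *-mono-≤ (^-monoʳ-≤ 2 (≤-trans (m∸n≤m ℓ 1) ℓ≤w)) (*-monoʳ-≤ E (*-monoˡ-≤ (q ^ k) hδ)) ⟩
    2 ^ w * (E * (q ^ (w ∸ ℓ) * q ^ k)) ≡⟨ cong (λ z → 2 ^ w * (E * z)) (trans (sym (^-distribˡ-+-* q (w ∸ ℓ) k)) (cong (q ^_) expo)) ⟩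
    2 ^ w * (E * q ^ (w ∸ 1))   ≤⟨ *-monoʳ-≤ (2 ^ w) hH ⟩
    2 ^ w * (C * H)             ≡⟨ *-assoc (2 ^ w) C H ⟨
    2 ^ w * C * H               ∎
    where
    expo : w ∸ ℓ + (ℓ ∸ 1) ≡ w ∸ 1
    expo = trans (sym (+-∸-assoc (w ∸ ℓ) 1≤ℓ)) (cong (_∸ 1) (m∸n+n≡m ℓ≤w))

-- The balanced family

Nonempty⇒∣∣>0 : ∀ {k} (I : Subset k) → Nonempty I → 0 < ∣ I ∣
Nonempty⇒∣∣>0 I (i , i∈I) = ≤-trans (s≤s z≤n) (x∈p⇒∣p-x∣<∣p∣ i∈I)

^-unfold : ∀ q {k} → 1 ≤ k → q ^ k ≡ q * q ^ (k ∸ 1)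
^-unfold q {suc k} _ = refl

-- The factor 4st comes from the two choppings, 2^s · 2^t from the pairs of position sets, the power
-- of `density` from exchanging q for r, and the powers of s + t from placing the vertices of `h` in
-- arbitrary positions.
copyConstant : ℕ → ℕ → ℕ
copyConstant s t = 4 * s * t * (2 ^ s * 2 ^ t * (density s t ^ (s + t) * (s + t) ^ t * (s + t) ^ s * ((s + t) * (s + t))))

density-pos : ∀ {s t} → 1 ≤ s → 1 ≤ t → 1 ≤ density s t
density-pos {s} {t} 1≤s 1≤t = *-mono-≤ (^-pos s (*-mono-≤ {1} {4} (s≤s z≤n) 1≤s)) (*-mono-≤ {1} {4} (s≤s z≤n) 1≤t)

copyConstant-pos : ∀ {s t} → 1 ≤ s → 1 ≤ t → 1 ≤ copyConstant s t
copyConstant-pos {s} {t} 1≤s 1≤t =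
  *-mono-≤ (*-mono-≤ (*-mono-≤ {1} {4} (s≤s z≤n) 1≤s) 1≤t)
  (*-mono-≤ (*-mono-≤ {1} (^-pos s (s≤s z≤n)) (^-pos t (s≤s z≤n)))
  (*-mono-≤ (*-mono-≤ (*-mono-≤ {1} (^-pos (s + t) (density-pos 1≤s 1≤t)) (^-pos t 1≤s+t)) (^-pos s 1≤s+t)) (*-mono-≤ 1≤s+t 1≤s+t)))
  where
  1≤s+t : 1 ≤ s + t
  1≤s+t = ≤-trans 1≤s (m≤m+n s t)

module Supersaturation {s t : ℕ} (2≤s : 2 ≤ s) (1≤t : 1 ≤ t) {n : ℕ} (1≤n : 1 ≤ n) (G : Graph n)
  (dense : (4 * s * (2 * t)) ^ s * n ^ (2 * s ∸ 1) ≤ e G ^ s) where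

  private
    b D c : ℕ
    b = s * t + 1
    D = density s t
    c = s + t
    1≤s : 1 ≤ s
    1≤s = <⇒≤ 2≤s
    1≤D : 1 ≤ D
    1≤D = density-pos 1≤s 1≤t
    i₀ : Fin s
    i₀ = fromℕ< 1≤s
    j₀ : Fin t
    j₀ = fromℕ< 1≤t

  open Construction {n} {s} {t} G i₀ j₀

  -- The first inequality for `q` is k^(1+ε) ≤ 2q raised to the power s · st, with ε = 1/(st).
  Balanced : Set
  Balanced = Σ (List (EdgeMat n)) λ ℋ →
    ℋ ≢ [] × Unique ℋ × All (IsKstCopy s t G) ℋ ×
    ∃ λ q → 1 ≤ q × e G ^ (s * b) ≤ (2 * q) ^ (s * (s * t)) * n ^ ((2 * s ∸ 1) * b) ×
      e G * q ^ (s * t ∸ 1) ≤ copyConstant s t * length ℋ ×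
      (∀ σ → IsSimple σ → 1 ≤ numEdges σ → degree ℋ σ ≤ q ^ (s * t ∸ numEdges σ))

  private
    E : ℕ
    E = e G

    E-lower : 2 * s * n ≤ E
    E-lower = edges-lower {s} {t} 1≤s 1≤t 1≤n dense

    1≤E : 1 ≤ E
    1≤E = ≤-trans (*-mono-≤ (*-mono-≤ {1} {2} (s≤s z≤n) 1≤s) 1≤n) E-lower

    module Parts {m : ℕ} (1≤m : 1 ≤ m) (m-lower : 2 * s * n * m ≤ E) (m-upper : E ≤ 2 * (2 * s * n * m)) where

      open Stars 1≤m

      X : ℕ
      X = numBlocks₁ * m ^ s

      E≤ : E ≤ 2 * (numBlocks₁ * (s * m))
      E≤ = ≤-half (numBlocks₁ * (s * m)) (n * (s * m)) ≤-numBlocks₁ (≤-trans (≤-reflexive (rearrange s n m)) m-lower)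
        where
        rearrange : ∀ s n m → 2 * (n * (s * m)) ≡ 2 * s * n * m
        rearrange = solve-∀

      E^s≤ : E ^ s ≤ (4 * s) ^ s * n ^ (s ∸ 1) * X
      E^s≤ = edges^s-upper {s} {n} {E} {numBlocks₁} {m} 1≤s E≤ m-upper

      X-lower : 2 * t * n ^ s ≤ X
      X-lower = stars-lower {s} {t} {n} {E} 1≤s 1≤t 1≤n dense E^s≤

      module Family {r q : ℕ} (1≤r : 1 ≤ r) (r-lower : 2 * t * n ^ s * r ≤ X) (r-upper : X ≤ 2 * (2 * t * n ^ s * r))
        (1≤q : 1 ≤ q) (q-lower : q ^ (s * (s * t)) * n ^ ((2 * s ∸ 1) * b) ≤ E ^ (s * b))
        (q< : E ^ (s * b) < suc q ^ (s * (s * t)) * n ^ ((2 * s ∸ 1) * b)) where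

        open Bicliques 1≤r
        open Greedy {n} {s} {t} q 1≤q

        H : List (Biclique n s t)
        H = greedy bicliques

        suc-q≤2q : suc q ≤ 2 * q
        suc-q≤2q = ≤-trans (+-monoˡ-≤ q 1≤q) (≤-reflexive (cong (q +_) (sym (+-identityʳ q))))

        q^≤ : q ^ (s * (s * t)) ≤ (D * r) ^ b
        q^≤ = q-upper {s} {t} {q} {n} {E} {D} {r} 2≤s 1≤n (edges^s≤density {s} {t} {n} {E} {X} {r} 1≤s E^s≤ r-upper) q-lower

        Z : ℕ
        Z = c ^ t * r ^ t * (c ^ s * m ^ s * (c * c))

        pair-bound : ∀ I J h → Nonempty I → Nonempty J →
          q ^ (∣ I ∣ * ∣ J ∣) * ∑ bicliques (sharing I J h) * (r * m) ≤ q * (D ^ (s + t) * Z)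
        pair-bound I J h I≢∅ J≢∅ = sharing-bound {s} {t} {q} {D} {r} {m} {∣ I ∣} {∣ J ∣} 2≤s 1≤D 1≤r
          (r≤m {s} {t} {n} {E} {numBlocks₁} {m} {r} 2≤s 1≤t 1≤n (numEdges-≤ (Graph.mat G)) numBlocks₁-≤ m-lower r-lower)
          (Nonempty⇒∣∣>0 I I≢∅) (Nonempty⇒∣∣>0 J J≢∅) (∣p∣≤n I) (∣p∣≤n J) q^≤
          (≤-trans (∑-sharing I J h I≢∅ J≢∅)
            (≤-reflexive (cong₂ (λ x y → x * (y * (c * c))) (^-distribʳ-* c r t) (^-distribʳ-* c m s))))

        X≤ : X ≤ 2 * (numBlocks₂ * (t * r))
        X≤ = ≤-half (numBlocks₂ * (t * r)) (n ^ s * (t * r)) ≤-numBlocks₂ (≤-trans (≤-reflexive (rearrange t (n ^ s) r)) r-lower)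
          where
          rearrange : ∀ t a r → 2 * (a * (t * r)) ≡ 2 * t * a * r
          rearrange = solve-∀

        many : E * q ^ (s * t ∸ 1) ≤ copyConstant s t * length H
        many = edges≤copies {s} {t} {E} {numBlocks₁} {numBlocks₂} {m} {r} {q} {Q = q ^ (s * t ∸ 1)} {H = length H}
          {a = r ^ t} {b = m ^ s} {P = 2 ^ s} {P′ = 2 ^ t} {D = D ^ (s + t)} {c = c ^ t} {d = c ^ s} {f = c * c}
          1≤q (^-pos t 1≤r) (^-pos s 1≤m) E≤ X≤
          (subst₂ (λ k l → k * l * (r * m) ≤ 2 ^ s * (2 ^ t * (length H * (q * (D ^ (s + t) * Z))))) length-bicliques
            (^-unfold q (*-mono-≤ 1≤s 1≤t))
            (greedy-count q 1≤q i₀ j₀ bicliques pair-bound))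

        ℋ≢[] : map edgeSet H ≢ []
        ℋ≢[] eq = <⇒≱ (*-mono-≤ 1≤E (^-pos (s * t ∸ 1) 1≤q)) (begin
          E * q ^ (s * t ∸ 1)          ≤⟨ many ⟩
          copyConstant s t * length H  ≡⟨ cong (copyConstant s t *_) (trans (sym (length-map edgeSet H)) (cong length eq)) ⟩
          copyConstant s t * 0         ≡⟨ *-zeroʳ (copyConstant s t) ⟩
          0                            ∎)
          where open ≤-Reasoning

        family : Balanced
        family = map edgeSet H , ℋ≢[] , greedy-Unique i₀ j₀ bicliques ,
          All-map⁺ (greedy-All (All.tabulate biclique-copy)) ,
          q , 1≤q ,
          ≤-trans (<⇒≤ q<) (*-monoˡ-≤ (n ^ ((2 * s ∸ 1) * b)) (^-monoˡ-≤ (s * (s * t)) suc-q≤2q)) ,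
          subst (λ k → E * q ^ (s * t ∸ 1) ≤ copyConstant s t * k) (sym (length-map edgeSet H)) many ,
          λ σ simple 1≤σ → greedy-degree (All.tabulate biclique-Ordered) simple 1≤σ

  balanced : Balanced
  balanced =
    -- The factor 2 in both divisors keeps the discarded leaves and stars to at most half: there are
    -- n keys in the first stage and n^s in the second.
    let m , 1≤m , m-lower , m-upper = quotient E (2 * s * n) (*-mono-≤ (*-mono-≤ {1} {2} (s≤s z≤n) 1≤s) 1≤n) E-lower
        r , 1≤r , r-lower , r-upper = quotient _ (2 * t * n ^ s)
          (*-mono-≤ (*-mono-≤ {1} {2} (s≤s z≤n) 1≤t) (^-pos s 1≤n)) (Parts.X-lower 1≤m m-lower m-upper)
        q , 1≤q , q-lower , q< = root (s * (s * t)) (n ^ ((2 * s ∸ 1) * b)) (E ^ (s * b))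
          (*-mono-≤ 1≤s (*-mono-≤ 1≤s 1≤t)) (^-pos ((2 * s ∸ 1) * b) 1≤n) N≤Z
    in Parts.Family.family 1≤m m-lower m-upper 1≤r r-lower r-upper 1≤q q-lower q<
    where
    N≤Z : n ^ ((2 * s ∸ 1) * b) ≤ E ^ (s * b)
    N≤Z = subst₂ _≤_ (^-*-assoc n (2 * s ∸ 1) b) (^-*-assoc E s b) (^-monoˡ-≤ b
      (≤-trans (m≤n*m (n ^ (2 * s ∸ 1)) ((4 * s * (2 * t)) ^ s)
        {{>-nonZero (^-pos s (*-mono-≤ (*-mono-≤ {1} {4} (s≤s z≤n) 1≤s) (*-mono-≤ {1} {2} (s≤s z≤n) 1≤t)))}}) dense))

-- With ε = a / b and k^s = e(G)^s / n^(2s-1), the condition k ≥ k₀ is raised to the power s and the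
-- codegree bound to the power s · b, which leaves only integer exponents.
theorem7p1 : (s t : ℕ) → 2 ≤ s → s ≤ t →
    Σ ℕ λ C → Σ ℕ λ a → Σ ℕ λ b → Σ ℕ λ k₀ →
    (0 < C) × (0 < a) × (0 < b) ×
    ((n : ℕ) → 1 ≤ n → (G : Graph n) →
    k₀ ^ s * n ^ (2 * s ∸ 1) ≤ e G ^ s →
    Σ (List (EdgeMat n)) λ ℋ →
    (ℋ ≢ []) × Unique ℋ × All (IsKstCopy s t G) ℋ ×
    ((σ : EdgeMat n) → IsSimple σ → σ ⊆ Graph.mat G →
    1 ≤ numEdges σ → numEdges σ ≤ s * t →
    degree ℋ σ ^ (s * b) * e G ^ (s * (b + a) * (numEdges σ ∸ 1)) * e G ^ (s * b)
    ≤ (C * length ℋ) ^ (s * b) * n ^ ((2 * s ∸ 1) * (b + a) * (numEdges σ ∸ 1))))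
theorem7p1 s t 2≤s s≤t =
  -- So ε = 1/(st). The power of 2 pays for replacing k^(1+ε) by 2q at each edge. In k₀, the factor
  -- 4s offsets the loss in counting stars, and 2t then makes r positive.
  2 ^ (s * t) * copyConstant s t , 1 , s * t , 4 * s * (2 * t) ,
  *-mono-≤ (^-pos {2} (s * t) (s≤s z≤n)) (copyConstant-pos 1≤s 1≤t) , s≤s z≤n , *-mono-≤ 1≤s 1≤t ,
  λ n 1≤n G dense → let
      ℋ , ℋ≢[] , unique , copies , q , 1≤q , q-upper , many , deg = Supersaturation.balanced 2≤s 1≤t 1≤n G dense
    in ℋ , ℋ≢[] , unique , copies , λ σ simple _ 1≤σ σ≤st →
      subst₂ (λ x y → degree ℋ σ ^ (s * (s * t)) * x * e G ^ (s * (s * t)) ≤ (2 ^ (s * t) * copyConstant s t * length ℋ) ^ (s * (s * t)) * y)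
        (^-*-assoc (e G) (s * (s * t + 1)) (numEdges σ ∸ 1))
        (^-*-assoc n ((2 * s ∸ 1) * (s * t + 1)) (numEdges σ ∸ 1))
        (degree-bound {s * (s * t)} {q} {s * t} {H = length ℋ} 1≤q q-upper 1≤σ σ≤st (deg σ simple 1≤σ) many)
  where
  1≤s : 1 ≤ s
  1≤s = <⇒≤ 2≤s
  1≤t : 1 ≤ t
  1≤t = ≤-trans 1≤s s≤t
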